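{- Let $A(n;k,\ell,m)$ denote the number of four-coloured partitions of $n$ with the ordering $1_{a} < 1_{b} < 1_{c} <1_{d} <2_{a} < 2_{b} <2_{c} < 2_{d} < \cdots$ and the difference conditions given by the matrix $D$ below, having $k$ parts coloured $a$, $\ell$ parts coloured $c$ and $m$ parts coloured $d$. Then $$\sum_{n,k,\ell,m \geq 0} A(n;k,\ell,m) q^n a^k c^{\ell} d^m = \frac{(-aq;q^2)_{\infty}(-dq;q^2)_{\infty}}{(q;q)_{\infty}(cq;q^2)_{\infty}}.$$
   Context: Here $(a;q)_n := \prod_{j=0}^{n-1}(1-aq^j)$ for $n \in \mathbb{N}\cup\{\infty\}$. Consider partitions $(\lambda_1,\lambda_2,\dots)$ into parts of four colours $a,b,c,d$, where $k_z$ denotes the part $k\in\mathbb{N}$ of colour $z\in\{a,b,c,d\}$, with the order $1_{a} < 1_{b} < 1_{c} <1_{d} <2_{a} < 2_{b} <2_{c} < 2_{d} < \cdots$. The minimal difference $\lambda_i-\lambda_{i+1}$ between consecutive parts $\lambda_i$ of colour $x$ and $\lambda_{i+1}$ of colour $y$ is the entry $(x,y)$ of the matrix $D$ with rows/columns indexed by $a,b,c,d$: row $a$: $(2,1,2,2)$; row $b$: $(1,0,1,1)$; row $c$: $(0,1,0,2)$; row $d$: $(0,1,0,2)$. -}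

module Defs where

open import Data.Nat using (ℕ; zero; suc; _∸_; _≤ᵇ_; _≡ᵇ_)
import Data.Nat as ℕ
open import Data.Integer using (ℤ; +_)
import Data.Integer as ℤ
open import Data.Bool using (Bool; true; false; _∧_)
open import Data.List using (List; []; _∷_)
open import Data.Product using (_×_; _,_; Σ)
open import Data.Fin using (Fin)
open import Function.Bundles using (_↔_)
open import Relation.Binary.PropositionalEquality using (_≡_)

data Colour : Set where
  a b c d : Colour

rank : Colour → ℕ
rank a = 0
rank b = 1
rank c = 2
rank d = 3

-- The matrix D (row = colour of λ_i, column = colour of λ_{i+1})
D : Colour → Colour → ℕ
D a a = 2
D a b = 1
D a c = 2
D a d = 2
D b a = 1
D b b = 0
D b c = 1
D b d = 1
D c a = 0
D c b = 1
D c c = 0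
D c d = 2
D d a = 0
D d b = 1
D d c = 0
D d d = 2

-- A coloured part k_z is a pair (k , z); k must be ≥ 1.
Part : Set
Part = ℕ × Colour

-- position of k_z in the total order 1_a < 1_b < 1_c < 1_d < 2_a < ...
key : Part → ℕ
key (k , z) = 4 ℕ.* k ℕ.+ rank z

consecutiveOK : Part → Part → Bool
consecutiveOK (k , x) (k' , y) =
  (key (k' , y) ≤ᵇ key (k , x)) ∧ ((k' ℕ.+ D x y) ≤ᵇ k)

positive : Part → Bool
positive (k , _) = 1 ≤ᵇ k

valid : List Part → Bool
valid [] = true
valid (p ∷ []) = positive p
valid (p ∷ p' ∷ ps) = positive p ∧ consecutiveOK p p' ∧ valid (p' ∷ ps)

size : List Part → ℕ
size [] = 0
size ((k , _) ∷ ps) = k ℕ.+ size ps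

isColour : Colour → Colour → Bool
isColour a a = true
isColour b b = true
isColour c c = true
isColour d d = true
isColour _ _ = false

count : Colour → List Part → ℕ
count z [] = 0
count z ((_ , y) ∷ ps) with isColour z y
... | true = suc (count z ps)
... | false = count z ps

isA : ℕ → ℕ → ℕ → ℕ → List Part → Bool
isA n k ℓ m p =
  valid p ∧ (size p ≡ᵇ n) ∧ (count a p ≡ᵇ k) ∧ (count c p ≡ᵇ ℓ) ∧ (count d p ≡ᵇ m)

APartitions : ℕ → ℕ → ℕ → ℕ → Set
APartitions n k ℓ m = Σ (List Part) (λ p → isA n k ℓ m p ≡ true)

-- Formal power series in q, a, c, d with integer coefficients.
-- f n k ℓ m is the coefficient of q^n a^k c^ℓ d^m.

Series : Set
Series = ℕ → ℕ → ℕ → ℕ → ℤ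

sumTo : ℕ → (ℕ → ℤ) → ℤ
sumTo zero f = f 0
sumTo (suc n) f = sumTo n f ℤ.+ f (suc n)

_⊕_ : Series → Series → Series
(f ⊕ g) n k ℓ m = f n k ℓ m ℤ.+ g n k ℓ m

⊖_ : Series → Series
(⊖ f) n k ℓ m = ℤ.- f n k ℓ m

_⊛_ : Series → Series → Series
(f ⊛ g) n k ℓ m =
  sumTo n λ n₁ → sumTo k λ k₁ → sumTo ℓ λ ℓ₁ → sumTo m λ m₁ →
    f n₁ k₁ ℓ₁ m₁ ℤ.* g (n ∸ n₁) (k ∸ k₁) (ℓ ∸ ℓ₁) (m ∸ m₁)

infixl 6 _⊕_
infixl 7 _⊛_

mono : ℤ → ℕ → ℕ → ℕ → ℕ → Series
mono z e i j l n k ℓ m =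
  if' ((e ≡ᵇ n) ∧ (i ≡ᵇ k) ∧ (j ≡ᵇ ℓ) ∧ (l ≡ᵇ m))
  where
    if' : Bool → ℤ
    if' true = z
    if' false = + 0

one : Series
one = mono (+ 1) 0 0 0 0

qpow : ℕ → Series
qpow e = mono (+ 1) e 0 0 0

𝕢 𝕒 𝕔 𝕕 : Series
𝕢 = mono (+ 1) 1 0 0 0
𝕒 = mono (+ 1) 0 1 0 0
𝕔 = mono (+ 1) 0 0 1 0
𝕕 = mono (+ 1) 0 0 0 1

_^ˢ_ : Series → ℕ → Series
f ^ˢ zero = one
f ^ˢ suc i = f ⊛ (f ^ˢ i)

-- 1/(1 - X) = Σ_{i ≥ 0} X^i, for X with zero constant term in q
-- (X has q-valuation ≥ 1, so only i ≤ n contributes to q^n).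
geom : Series → Series
geom X n k ℓ m = sumTo n (λ i → (X ^ˢ i) n k ℓ m)

prodTo : ℕ → (ℕ → Series) → Series
prodTo zero F = F 0
prodTo (suc N) F = prodTo N F ⊛ F (suc N)

-- infinite product ∏_{j ≥ 0} F j, where F j ≡ 1 modulo q^(j+1);
-- the coefficient of q^n is then that of the finite product over j ≤ n.
prodInf : (ℕ → Series) → Series
prodInf F n k ℓ m = prodTo n F n k ℓ m

poch∞ : Series → ℕ → Series
poch∞ x s = prodInf (λ j → one ⊕ ⊖ (x ⊛ qpow (s ℕ.* j)))

invPoch∞ : Series → ℕ → Series
invPoch∞ x s = prodInf (λ j → geom (x ⊛ qpow (s ℕ.* j)))

RHS : Series
RHS = poch∞ (⊖ (𝕒 ⊛ 𝕢)) 2 ⊛ poch∞ (⊖ (𝕕 ⊛ 𝕢)) 2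
      ⊛ invPoch∞ 𝕢 1 ⊛ invPoch∞ (𝕔 ⊛ 𝕢) 2

{-# OPTIONS --safe #-}
module Submission where

-- Let F_k and V_k be the generating functions of the partitions that may follow a part k_b and k_c. Rows a and b of
-- D differ by the constant 1 and rows c and d agree, so these two sequences suffice, and comparing neighbouring
-- cases gives a linear system for F and V. In terms of F(z) = Σ F_k z^k and the dilation η : z ↦ q z, eliminating V
-- leaves a second-order equation for F. It is solved by F(z) = (−z;q)_∞ Σ_j K_j z^{2j} with
--   K_j = (−aq;q²)_j (−dq;q²)_j / ((q²;q²)_j (cq;q²)_j),
-- because dividing by (−z;q)_∞ turns it into a first-order recurrence for K_j. Since
-- (−z;q)_∞ / (z²;q²)_∞ = 1/(z;q)_∞, replacing (q²;q²)_j K_j by its limit shows that F_k tends q-adically to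
-- (−aq;q²)_∞ (−dq;q²)_∞ / ((q;q)_∞ (cq;q²)_∞); and F_k agrees with the counting series below q^k.

open import Defs
open import Algebra.Bundles using (CommutativeRing)
import Algebra.Properties.CommutativeSemigroup
import Algebra.Properties.Ring
import Algebra.Properties.Semiring.Exp
import Algebra.Properties.Semiring.Mult.TCOptimised
import Algebra.Solver.Ring
open import Algebra.Solver.Ring.AlmostCommutativeRing using (_-Raw-AlmostCommutative⟶_; fromCommutativeRing)
open import Axiom.UniquenessOfIdentityProofs using (module Decidable⇒UIP)
open import Data.Bool using (Bool; true; false; _∧_; T)
import Data.Bool.Properties as Bool
open import Data.Empty using (⊥; ⊥-elim)
open import Data.Fin using (Fin)
open import Data.Fin.Permutation using (↔⇒≡)
open import Data.Fin.Properties using (0↔⊥; 1↔⊤; +↔⊎)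
open import Data.Integer as ℤ using (ℤ; +_; -[1+_])
import Data.Integer.Properties as ℤ
open import Data.List using (List; []; _∷_)
open import Data.Maybe.Base using (Maybe; just; nothing)
open import Data.Nat as ℕ using (ℕ; zero; suc; _∸_; _≤_; _<_; z≤n; s≤s)
import Data.Nat.Properties as ℕ
open import Data.Product using (Σ; _×_; _,_; proj₁)
open import Data.Sum using (_⊎_; inj₁; inj₂)
open import Data.Sum.Function.Propositional using (_⊎-↔_)
open import Data.Unit using (tt)
open import Function.Bundles using (_↔_; mk↔ₛ′)
open import Function.Properties.Inverse using (↔-trans; ↔-sym)
import Relation.Binary.Reasoning.Setoid
open import Relation.Binary.PropositionalEquality as ≡ using (_≡_)
open import Relation.Nullary using (¬_)
open import Relation.Nullary.Decidable using (yes; no)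

-- As a linear relation between F, ηF and η²F, the second-order equation has the coefficient q(1 -
-- z) at F and (1 + qz)(γ - αδq³z²) at η²F. If F = E·K with E = (1 + z)·ηE, the first coefficient is
-- completed to q(1 - z²) and the common factor 1 + qz drops out, leaving only even powers of z.
-- Hence (-z;q)_∞ is the right divisor, and K can be even with a two-term recurrence.
--
-- Uniqueness is the delicate point. At z^n the equation multiplies the unknown coefficient by (1 -
-- x)(q - γx) with x = q^n. This is 0 at n = 0, contains 1 - γ at n = 1, and has the non-unit factor
-- q for all n ≥ 1. So two initial values are prescribed, and q is cancelled instead of inverted.
--
-- The eliminations are certified by explicit multipliers of the hypotheses, which reduces them to
-- polynomial identities.
--
-- Infinite products and 1/(1 - x) are diagonals of partial products and partial sums, so limits are
-- handled as congruences modulo powers of q. With q as the outermost variable, such a congruence is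
-- just a bound on the first index.

-- Integer coefficients for solving identities in an arbitrary commutative ring.

module IntSolver {o ℓ} (R : CommutativeRing o ℓ) where
  open CommutativeRing R hiding (zero)
  open Algebra.Properties.Ring ring
  open Algebra.Properties.Semiring.Mult.TCOptimised semiring renaming (_×_ to _⊠_)
  open Relation.Binary.Reasoning.Setoid setoid

  -- The optimised multiple `1 ⊠ 1#` computes to `1#`, so in solver goals `con (ℤ.+ 1)` matches `1#`
  -- itself.
  fromℤ : ℤ → Carrier
  fromℤ (+ n) = n ⊠ 1#
  fromℤ -[1+ n ] = - (suc n ⊠ 1#)

  fromℤ-⊖ : ∀ m n → fromℤ (m ℤ.⊖ n) ≈ m ⊠ 1# - n ⊠ 1#
  fromℤ-⊖ m zero = sym (trans (+-congˡ -0#≈0#) (+-identityʳ _))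
  fromℤ-⊖ zero (suc n) = sym (+-identityˡ _)
  fromℤ-⊖ (suc m) (suc n) = begin
    fromℤ (suc m ℤ.⊖ suc n)                   ≡⟨ ≡.cong fromℤ (ℤ.[1+m]⊖[1+n]≡m⊖n m n) ⟩
    fromℤ (m ℤ.⊖ n)                           ≈⟨ fromℤ-⊖ m n ⟩
    m ⊠ 1# - n ⊠ 1#                           ≈⟨ +-congʳ (+-identityʳ _) ⟨
    m ⊠ 1# + 0# - n ⊠ 1#                      ≈⟨ +-congʳ (+-congˡ (-‿inverseʳ 1#)) ⟨
    m ⊠ 1# + (1# - 1#) - n ⊠ 1#               ≈⟨ +-congʳ (+-assoc _ _ _) ⟨
    m ⊠ 1# + 1# - 1# - n ⊠ 1#                 ≈⟨ +-assoc _ _ _ ⟩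
    m ⊠ 1# + 1# + (- 1# - n ⊠ 1#)             ≈⟨ +-cong (+-comm _ _) (-‿+-comm 1# (n ⊠ 1#)) ⟩
    1# + m ⊠ 1# - (1# + n ⊠ 1#)               ≈⟨ +-cong (1+× m 1#) (-‿cong (1+× n 1#)) ⟨
    suc m ⊠ 1# - suc n ⊠ 1#                   ∎

  fromℤ-+ : ∀ x y → fromℤ (x ℤ.+ y) ≈ fromℤ x + fromℤ y
  fromℤ-+ (+ m) (+ n) = ×-homo-+ 1# m n
  fromℤ-+ (+ m) -[1+ n ] = fromℤ-⊖ m (suc n)
  fromℤ-+ -[1+ m ] (+ n) = trans (fromℤ-⊖ n (suc m)) (+-comm _ _)
  fromℤ-+ -[1+ m ] -[1+ n ] = trans
    (-‿cong (trans (reflexive (≡.cong (_⊠ 1#) (≡.sym (ℕ.+-suc (suc m) n)))) (×-homo-+ 1# (suc m) (suc n))))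
    (sym (-‿+-comm _ _))

  fromℤ-neg : ∀ x → fromℤ (ℤ.- x) ≈ - fromℤ x
  fromℤ-neg (+ zero) = sym -0#≈0#
  fromℤ-neg (+ suc n) = refl
  fromℤ-neg -[1+ n ] = sym (-‿involutive _)

  fromℤ-pos-* : ∀ m y → fromℤ (+ m ℤ.* y) ≈ m ⊠ 1# * fromℤ y
  fromℤ-pos-* m (+ n) = trans (reflexive (≡.cong fromℤ (≡.sym (ℤ.pos-* m n)))) (×1-homo-* m n)
  fromℤ-pos-* m -[1+ n ] = begin
    fromℤ (+ m ℤ.* -[1+ n ])       ≡⟨ ≡.cong fromℤ (ℤ.neg-distribʳ-* (+ m) (+ suc n)) ⟨
    fromℤ (ℤ.- (+ m ℤ.* + suc n))  ≈⟨ fromℤ-neg (+ m ℤ.* + suc n) ⟩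
    - fromℤ (+ m ℤ.* + suc n)      ≈⟨ -‿cong (fromℤ-pos-* m (+ suc n)) ⟩
    - (m ⊠ 1# * suc n ⊠ 1#)        ≈⟨ -‿distribʳ-* _ _ ⟩
    m ⊠ 1# * - (suc n ⊠ 1#)        ∎

  fromℤ-* : ∀ x y → fromℤ (x ℤ.* y) ≈ fromℤ x * fromℤ y
  fromℤ-* (+ m) y = fromℤ-pos-* m y
  fromℤ-* -[1+ m ] y = begin
    fromℤ (-[1+ m ] ℤ.* y)         ≡⟨ ≡.cong fromℤ (ℤ.neg-distribˡ-* (+ suc m) y) ⟨
    fromℤ (ℤ.- (+ suc m ℤ.* y))    ≈⟨ fromℤ-neg (+ suc m ℤ.* y) ⟩
    - fromℤ (+ suc m ℤ.* y)        ≈⟨ -‿cong (fromℤ-pos-* (suc m) y) ⟩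
    - (suc m ⊠ 1# * fromℤ y)       ≈⟨ -‿distribˡ-* _ _ ⟩
    - (suc m ⊠ 1#) * fromℤ y       ∎

  homomorphism : ℤ.+-*-rawRing -Raw-AlmostCommutative⟶ fromCommutativeRing R
  homomorphism = record
    { ⟦_⟧ = fromℤ ; +-homo = fromℤ-+ ; *-homo = fromℤ-* ; -‿homo = fromℤ-neg ; 0-homo = refl ; 1-homo = refl }

  coeff≟ : ∀ x y → Maybe (fromℤ x ≈ fromℤ y)
  coeff≟ x y with x ℤ.≟ y
  ... | yes x≡y = just (reflexive (≡.cong fromℤ x≡y))
  ... | no _ = nothing

  open Algebra.Solver.Ring ℤ.+-*-rawRing (fromCommutativeRing R) homomorphism coeff≟ public
    using (solve; _:=_; _:+_; _:*_; _:-_; :-_; con)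

-- Polynomial identities behind the elimination and the recurrences.

module Elimination {o ℓ} (R : CommutativeRing o ℓ) where
  open CommutativeRing R hiding (zero)
  open Algebra.Properties.Ring ring using (x≈y⇒x∙y⁻¹≈ε; x∙y⁻¹≈ε⇒x≈y)
  open Relation.Binary.Reasoning.Setoid setoid
  open IntSolver R

  vanishes : ∀ k {l r} → l ≈ r → k * (l - r) ≈ 0#
  vanishes k p = trans (*-congˡ (x≈y⇒x∙y⁻¹≈ε p)) (zeroʳ k)

  -- Ideal membership: once x - y is exhibited as a combination of the differences of the
  -- hypotheses, the rest is a polynomial identity for the solver.
  combine₂ : ∀ {x y} k₁ {l₁ r₁} k₂ {l₂ r₂} → x - y ≈ k₁ * (l₁ - r₁) + k₂ * (l₂ - r₂) →
             l₁ ≈ r₁ → l₂ ≈ r₂ → x ≈ y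
  combine₂ k₁ k₂ eq p₁ p₂ = x∙y⁻¹≈ε⇒x≈y _ _
    (trans eq (trans (+-cong (vanishes k₁ p₁) (vanishes k₂ p₂)) (+-identityˡ 0#)))

  combine₃ : ∀ {x y} k₁ {l₁ r₁} k₂ {l₂ r₂} k₃ {l₃ r₃} →
             x - y ≈ k₁ * (l₁ - r₁) + k₂ * (l₂ - r₂) + k₃ * (l₃ - r₃) →
             l₁ ≈ r₁ → l₂ ≈ r₂ → l₃ ≈ r₃ → x ≈ y
  combine₃ k₁ k₂ k₃ eq p₁ p₂ p₃ = x∙y⁻¹≈ε⇒x≈y _ _
    (trans eq (trans (+-cong (trans (+-cong (vanishes k₁ p₁) (vanishes k₂ p₂)) (+-identityˡ 0#)) (vanishes k₃ p₃))
      (+-identityˡ 0#)))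

  -- The part of the second-order equation that carries a factor z. Coefficient n + 1 of the
  -- equation sees it only through coefficients of s, s₁, s₂ up to n, which makes induction
  -- possible.
  Ψ : (q α γ δ z s s₁ s₂ : Carrier) → Carrier
  Ψ q α γ δ z s s₁ s₂ =
    q * s + (α + δ) * q * q * (z * s₁) - q * γ * s₂ + α * δ * q * q * q * (z * s₂ + q * (z * (z * s₂)))

  -- e₁ p₁ = e₁ (1 - z²) p = (1 - z) e p.
  product-equation : ∀ {z e e₁ p p₁} → e ≈ e₁ + z * e₁ → p ≈ p₁ + z * (z * p) →
                     e * p ≈ e₁ * p₁ + z * (e * p)
  product-equation {z} {e} {e₁} {p} {p₁} = combine₂ (p - z * p) e₁
    (solve 5 (λ z e e₁ p p₁ → e :* p :- (e₁ :* p₁ :+ z :* (e :* p))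
       := (p :- z :* p) :* (e :- (e₁ :+ z :* e₁)) :+ e₁ :* (p :- (p₁ :+ z :* (z :* p))))
     refl z e e₁ p p₁)

  -- A second-order equation in z² for k becomes one in z for e k, because e and its dilates differ by the
  -- factors 1 + z and 1 + q z.
  dilation-equation-product : ∀ {q α γ δ z e e₁ e₂ k k₁ k₂} →
    e ≈ e₁ + z * e₁ → e₁ ≈ e₂ + q * (z * e₂) →
    q * k + γ * k₂ ≈ (q + γ) * k₁ + z * (z * (q * k + (α + δ) * q * q * k₁ + α * δ * q * q * q * k₂)) →
    q * (e * k) + γ * (e₂ * k₂) ≈ (q + γ) * (e₁ * k₁) + z * Ψ q α γ δ z (e * k) (e₁ * k₁) (e₂ * k₂)
  dilation-equation-product {q} {α} {γ} {δ} {z} {e} {e₁} {e₂} {k} {k₁} {k₂} =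
    combine₃ ((q - q * z) * k) (q * (1# - z * z) * k - (q + γ + (α + δ) * q * q * z * z) * k₁) (e₂ + q * (z * e₂))
      (solve 11 (λ q α γ δ z e e₁ e₂ k k₁ k₂ →
        q :* (e :* k) :+ γ :* (e₂ :* k₂) :- ((q :+ γ) :* (e₁ :* k₁) :+ z :*
          (q :* (e :* k) :+ (α :+ δ) :* q :* q :* (z :* (e₁ :* k₁)) :- q :* γ :* (e₂ :* k₂)
             :+ α :* δ :* q :* q :* q :* (z :* (e₂ :* k₂) :+ q :* (z :* (z :* (e₂ :* k₂))))))
        := (q :- q :* z) :* k :* (e :- (e₁ :+ z :* e₁))
           :+ (q :* (con (ℤ.+ 1) :- z :* z) :* k :- (q :+ γ :+ (α :+ δ) :* q :* q :* z :* z) :* k₁)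
                :* (e₁ :- (e₂ :+ q :* (z :* e₂)))
           :+ (e₂ :+ q :* (z :* e₂)) :* (q :* k :+ γ :* k₂ :- ((q :+ γ) :* k₁ :+
                z :* (z :* (q :* k :+ (α :+ δ) :* q :* q :* k₁ :+ α :* δ :* q :* q :* q :* k₂)))))
       refl q α γ δ z e e₁ e₂ k k₁ k₂)

  -- The hypotheses are the equation of F, the dilated equation of V and the dilated equation of F.
  -- The multiplier q(γ + δ)z of the second cancels v₁ from the first; it brings in v₂ with
  -- coefficient q(γ + δ)z(δqz - γ), which the multiplier δqz - γ of the third cancels.
  dilation-equation-eliminate : ∀ {q α γ δ z f f₁ f₂ v₁ v₂} →
    f ≈ f₁ + z * f + (γ + δ) * (z * v₁) + α * q * (z * (z * f₁)) →
    v₁ + f₂ + δ * (q * (z * v₂)) ≈ f₁ + α * q * (q * (z * f₂)) + γ * v₂ →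
    f₁ ≈ f₂ + q * (z * f₁) + (γ + δ) * (q * (z * v₂)) + α * q * (q * (z * (q * (z * f₂)))) →
    q * f + γ * f₂ ≈ (q + γ) * f₁ + z * Ψ q α γ δ z f f₁ f₂
  dilation-equation-eliminate {q} {α} {γ} {δ} {z} {f} {f₁} {f₂} {v₁} {v₂} =
    combine₃ q (q * (γ + δ) * z) (δ * q * z - γ)
      (solve 10 (λ q α γ δ z f f₁ f₂ v₁ v₂ →
        q :* f :+ γ :* f₂ :- ((q :+ γ) :* f₁ :+ z :*
          (q :* f :+ (α :+ δ) :* q :* q :* (z :* f₁) :- q :* γ :* f₂
             :+ α :* δ :* q :* q :* q :* (z :* f₂ :+ q :* (z :* (z :* f₂)))))
        := q :* (f :- (f₁ :+ z :* f :+ (γ :+ δ) :* (z :* v₁) :+ α :* q :* (z :* (z :* f₁))))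
           :+ q :* (γ :+ δ) :* z :* (v₁ :+ f₂ :+ δ :* (q :* (z :* v₂))
                :- (f₁ :+ α :* q :* (q :* (z :* f₂)) :+ γ :* v₂))
           :+ (δ :* q :* z :- γ) :* (f₁ :- (f₂ :+ q :* (z :* f₁) :+ (γ :+ δ) :* (q :* (z :* v₂))
                :+ α :* q :* (q :* (z :* (q :* (z :* f₂)))))))
       refl q α γ δ z f f₁ f₂ v₁ v₂)

  indicial-cancel : ∀ {q γ x y u v s t w} → (∀ {i j} → q * i ≈ q * j → i ≈ j) →
    u * (1# - x) ≈ 1# → v * (1# - γ * y) ≈ 1# → x ≈ q * y →
    q * s + γ * (x * (x * s)) ≈ (q + γ) * (x * s) + w →
    q * t + γ * (x * (x * t)) ≈ (q + γ) * (x * t) + w → s ≈ t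
  indicial-cancel {q} {γ} {x} {y} {u} {v} {s} {t} {w} q-cancel uinv vinv x≈qy eqs eqt =
    q-cancel (trans (sym (lemma s)) (trans (*-congˡ (trans (move eqs) (sym (move eqt)))) (lemma t)))
    where
    move : ∀ {f g} → f ≈ g + w → f - g ≈ w
    move {f} {g} eq = trans (+-congʳ eq) (solve 2 (λ g w → g :+ w :- g := w) refl g w)
    lemma : ∀ s → u * v * (q * s + γ * (x * (x * s)) - (q + γ) * (x * s)) ≈ q * s
    lemma s = begin
      u * v * (q * s + γ * (x * (x * s)) - (q + γ) * (x * s))
        ≈⟨ solve 6 (λ q γ x u v s → u :* v :* (q :* s :+ γ :* (x :* (x :* s)) :- (q :+ γ) :* (x :* s))
             := u :* (con (ℤ.+ 1) :- x) :* (v :* (q :- γ :* x)) :* s) refl q γ x u v s ⟩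
      u * (1# - x) * (v * (q - γ * x)) * s
        ≈⟨ *-congʳ (*-cong uinv (*-congˡ (+-congˡ (-‿cong (*-congˡ x≈qy))))) ⟩
      1# * (v * (q - γ * (q * y))) * s
        ≈⟨ solve 5 (λ q γ y v s → con (ℤ.+ 1) :* (v :* (q :- γ :* (q :* y))) :* s
             := v :* (con (ℤ.+ 1) :- γ :* y) :* (q :* s)) refl q γ y v s ⟩
      v * (1# - γ * y) * (q * s)
        ≈⟨ trans (*-congʳ vinv) (*-identityˡ _) ⟩
      q * s ∎

  -- The same factorisation, now at qx, turns the left side minus the first term on the right into
  -- q(1 - qx)(1 - γx)w, while the last bracket is q(1 + αx)(1 + δx)k. For x = q^(n+1) this is the
  -- step from K_n to K_(n+2).
  indicial-solve : ∀ {q α γ δ x y u v k w} →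
    u * (1# - q * x) ≈ 1# → v * (1# - γ * x) ≈ 1# → x ≈ q * y →
    w ≈ k * ((1# + α * x) * (1# + δ * x) * v * u) →
    q * w + γ * (q * x * (q * x * w)) ≈
    (q + γ) * (q * x * w) + (q * k + (α + δ) * q * q * (y * k) + α * δ * q * q * q * (y * (y * k)))
  indicial-solve {q} {α} {γ} {δ} {x} {y} {u} {v} {k} {w} uinv vinv x≈qy w≈ = begin
    q * w + γ * (q * x * (q * x * w))
      ≈⟨ solve 4 (λ q γ x w → q :* w :+ γ :* (q :* x :* (q :* x :* w))
           := (q :+ γ) :* (q :* x :* w) :+ q :* (con (ℤ.+ 1) :- q :* x) :* (con (ℤ.+ 1) :- γ :* x) :* w)
           refl q γ x w ⟩
    (q + γ) * (q * x * w) + q * (1# - q * x) * (1# - γ * x) * w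
      ≈⟨ +-congˡ (*-congˡ w≈) ⟩
    (q + γ) * (q * x * w) + q * (1# - q * x) * (1# - γ * x) * (k * ((1# + α * x) * (1# + δ * x) * v * u))
      ≈⟨ +-congˡ (solve 8 (λ q α γ δ x u v k → q :* (con (ℤ.+ 1) :- q :* x) :* (con (ℤ.+ 1) :- γ :* x)
             :* (k :* ((con (ℤ.+ 1) :+ α :* x) :* (con (ℤ.+ 1) :+ δ :* x) :* v :* u))
           := (u :* (con (ℤ.+ 1) :- q :* x)) :* (v :* (con (ℤ.+ 1) :- γ :* x))
             :* (q :* k :+ (α :+ δ) :* q :* (x :* k) :+ α :* δ :* q :* (x :* (x :* k)))) refl q α γ δ x u v k) ⟩
    (q + γ) * (q * x * w) + u * (1# - q * x) * (v * (1# - γ * x))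
      * (q * k + (α + δ) * q * (x * k) + α * δ * q * (x * (x * k)))
      ≈⟨ +-congˡ (*-cong (*-cong uinv vinv) (+-cong (+-congˡ (*-congˡ (*-congʳ x≈qy)))
           (*-congˡ (*-cong x≈qy (*-congʳ x≈qy))))) ⟩
    (q + γ) * (q * x * w) + 1# * 1# * (q * k + (α + δ) * q * (q * y * k) + α * δ * q * (q * y * (q * y * k)))
      ≈⟨ +-congˡ (solve 5 (λ q α δ y k → con (ℤ.+ 1) :* con (ℤ.+ 1)
             :* (q :* k :+ (α :+ δ) :* q :* (q :* y :* k) :+ α :* δ :* q :* (q :* y :* (q :* y :* k)))
           := q :* k :+ (α :+ δ) :* q :* q :* (y :* k) :+ α :* δ :* q :* q :* q :* (y :* (y :* k))) refl q α δ y k) ⟩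
    (q + γ) * (q * x * w) + (q * k + (α + δ) * q * q * (y * k) + α * δ * q * q * q * (y * (y * k))) ∎

  geometric-solve : ∀ {x y w t} → w * (1# - t) ≈ 1# → x ≈ y * w → x ≈ t * x + y
  geometric-solve {x} {y} {w} {t} inv eq = combine₂ (1# - t) y
    (solve 4 (λ x y w t → x :- (t :* x :+ y) := (con (ℤ.+ 1) :- t) :* (x :- y :* w)
        :+ y :* (w :* (con (ℤ.+ 1) :- t) :- con (ℤ.+ 1))) refl x y w t) eq inv

  geometric-unique : ∀ {x y w t} → w * (1# - t) ≈ 1# → x ≈ t * x + y → x ≈ y * w
  geometric-unique {x} {y} {w} {t} inv eq = combine₂ (- x) w
    (solve 4 (λ x y w t → x :- y :* w := (:- x) :* (w :* (con (ℤ.+ 1) :- t) :- con (ℤ.+ 1))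
        :+ w :* (x :- (t :* x :+ y))) refl x y w t) inv eq

  neg-neg-* : ∀ {x y p} → x * p ≈ y → - (- x * p) ≈ y
  neg-neg-* {x} {y} {p} eq = trans (solve 2 (λ x p → :- (:- x :* p) := x :* p) refl x p) eq

-- Formal power series over a commutative ring, truncation and dilation.

module PowerSeries {o ℓ} (R : CommutativeRing o ℓ) where
  open CommutativeRing R hiding (zero)
  open Algebra.Properties.CommutativeSemigroup +-commutativeSemigroup using (interchange; x∙yz≈y∙xz)
  open Algebra.Properties.Semiring.Exp semiring using (_^_)
  open Relation.Binary.Reasoning.Setoid setoid

  sum : ℕ → (ℕ → Carrier) → Carrier
  sum zero h = h 0
  sum (suc n) h = sum n h + h (suc n)

  sum-suc : ∀ n h → sum (suc n) h ≈ h 0 + sum n (λ i → h (suc i))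
  sum-suc zero h = refl
  sum-suc (suc n) h = trans (+-congʳ (sum-suc n h)) (+-assoc _ _ _)

  Coeffs : Set o
  Coeffs = ℕ → Carrier

  shift : Coeffs → Coeffs
  shift f n = f (suc n)

  infix 4 _≋_
  _≋_ : Coeffs → Coeffs → Set ℓ
  f ≋ g = ∀ n → f n ≈ g n

  infixl 7 _·_
  -- The Cauchy product by recursion on the first factor, so that the ring laws follow by induction
  -- on the index; `·-sum` recovers the convolution sum.
  _·_ : Coeffs → Coeffs → Coeffs
  (f · g) zero = f 0 * g 0
  (f · g) (suc n) = f 0 * g (suc n) + (shift f · g) n

  const : Carrier → Coeffs
  const x zero = x
  const x (suc n) = 0#

  ·-cong : ∀ {f f′ g g′} → f ≋ f′ → g ≋ g′ → f · g ≋ f′ · g′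
  ·-cong p r zero = *-cong (p 0) (r 0)
  ·-cong p r (suc n) = +-cong (*-cong (p 0) (r (suc n))) (·-cong (λ m → p (suc m)) r n)

  -- The recursion on the second factor, which is what commutativity has to match with the defining
  -- one.
  ·-suc : ∀ f g n → (f · g) (suc n) ≈ f (suc n) * g 0 + (f · shift g) n
  ·-suc f g zero = +-comm _ _
  ·-suc f g (suc n) = trans (+-congˡ (·-suc (shift f) g n)) (x∙yz≈y∙xz _ _ _)

  ·-comm : ∀ f g → f · g ≋ g · f
  ·-comm f g zero = *-comm _ _
  ·-comm f g (suc n) = trans (+-cong (*-comm _ _) (·-comm (shift f) g n)) (sym (·-suc g f n))

  ·-distribʳ : ∀ h f g → (λ n → f n + g n) · h ≋ (λ n → (f · h) n + (g · h) n)
  ·-distribʳ h f g zero = distribʳ _ _ _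
  ·-distribʳ h f g (suc n) =
    trans (+-cong (distribʳ _ _ _) (·-distribʳ h (shift f) (shift g) n)) (interchange _ _ _ _)

  ·-scale : ∀ x f g → (λ n → x * f n) · g ≋ (λ n → x * (f · g) n)
  ·-scale x f g zero = *-assoc _ _ _
  ·-scale x f g (suc n) = trans (+-cong (*-assoc _ _ _) (·-scale x (shift f) g n)) (sym (distribˡ _ _ _))

  ·-assoc : ∀ f g h → (f · g) · h ≋ f · (g · h)
  ·-assoc f g h zero = *-assoc _ _ _
  ·-assoc f g h (suc n) = begin
    f 0 * g 0 * h (suc n) + (shift (f · g) · h) n
      ≈⟨ +-cong (*-assoc _ _ _) (·-distribʳ h (λ m → f 0 * g (suc m)) (shift f · g) n) ⟩
    f 0 * (g 0 * h (suc n)) + (((λ m → f 0 * g (suc m)) · h) n + ((shift f · g) · h) n)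
      ≈⟨ +-congˡ (+-cong (·-scale (f 0) (shift g) h n) (·-assoc (shift f) g h n)) ⟩
    f 0 * (g 0 * h (suc n)) + (f 0 * (shift g · h) n + (shift f · (g · h)) n)
      ≈⟨ +-assoc _ _ _ ⟨
    f 0 * (g 0 * h (suc n)) + f 0 * (shift g · h) n + (shift f · (g · h)) n
      ≈⟨ +-congʳ (distribˡ _ _ _) ⟨
    f 0 * (g · h) (suc n) + (shift f · (g · h)) n ∎

  0·≋0 : ∀ f → (λ _ → 0#) · f ≋ (λ _ → 0#)
  0·≋0 f zero = zeroˡ _
  0·≋0 f (suc n) = trans (+-cong (zeroˡ _) (0·≋0 f n)) (+-identityˡ _)

  ·-sum : ∀ f g n → (f · g) n ≈ sum n (λ i → f i * g (n ∸ i))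
  ·-sum f g zero = refl
  ·-sum f g (suc n) = trans (+-congˡ (·-sum (shift f) g n)) (sym (sum-suc n (λ i → f i * g (suc n ∸ i))))

  const-· : ∀ x f → const x · f ≋ (λ n → x * f n)
  const-· x f zero = refl
  const-· x f (suc n) = trans (+-congˡ (0·≋0 f n)) (+-identityʳ _)

  ·-identityˡ : ∀ f → const 1# · f ≋ f
  ·-identityˡ f n = trans (const-· 1# f n) (*-identityˡ _)

  powerSeries : CommutativeRing o ℓ
  powerSeries = record
    { Carrier = Coeffs
    ; _≈_ = _≋_
    ; _+_ = λ f g n → f n + g n
    ; _*_ = _·_
    ; -_ = λ f n → - f n
    ; 0# = λ _ → 0#
    ; 1# = const 1#
    ; isCommutativeRing = record
      { isRing = record
        { +-isAbelianGroup = record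
          { isGroup = record
            { isMonoid = record
              { isSemigroup = record
                { isMagma = record
                  { isEquivalence = record
                    { refl = λ _ → refl
                    ; sym = λ p n → sym (p n)
                    ; trans = λ p r n → trans (p n) (r n)
                    }
                  ; ∙-cong = λ p r n → +-cong (p n) (r n)
                  }
                ; assoc = λ f g h n → +-assoc _ _ _
                }
              ; identity = (λ f n → +-identityˡ _) , (λ f n → +-identityʳ _)
              }
            ; inverse = (λ f n → -‿inverseˡ _) , (λ f n → -‿inverseʳ _)
            ; ⁻¹-cong = λ p n → -‿cong (p n)
            }
          ; comm = λ f g n → +-comm _ _
          }
        ; *-cong = ·-cong
        ; *-assoc = ·-assoc
        ; *-identity = ·-identityˡ , (λ f n → trans (·-comm f _ n) (·-identityˡ f n))
        ; distrib = (λ f g h n → trans (·-comm f _ n)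
                      (trans (·-distribʳ f g h n) (+-cong (·-comm g f n) (·-comm h f n))))
                  , ·-distribʳ
        }
      ; *-comm = ·-comm
      }
    }

  X : Coeffs
  X zero = 0#
  X (suc n) = const 1# n

  X·-zero : ∀ f → (X · f) 0 ≈ 0#
  X·-zero f = zeroˡ _

  X·-suc : ∀ f n → (X · f) (suc n) ≈ f n
  X·-suc f n = trans (+-cong (zeroˡ _) (·-identityˡ f n)) (+-identityˡ _)

  infix 4 _≋[_]_
  -- Congruence modulo `X` to the power N.
  _≋[_]_ : Coeffs → ℕ → Coeffs → Set ℓ
  f ≋[ N ] g = ∀ n → n < N → f n ≈ g n

  ·-cong-≤ : ∀ n {f f′ g g′} → (∀ m → m ≤ n → f m ≈ f′ m) → (∀ m → m ≤ n → g m ≈ g′ m) →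
             (f · g) n ≈ (f′ · g′) n
  ·-cong-≤ zero p r = *-cong (p 0 z≤n) (r 0 z≤n)
  ·-cong-≤ (suc n) p r = +-cong (*-cong (p 0 z≤n) (r (suc n) ℕ.≤-refl))
    (·-cong-≤ n (λ m m≤n → p (suc m) (s≤s m≤n)) (λ m m≤n → r m (ℕ.m≤n⇒m≤1+n m≤n)))

  ·-cong-[] : ∀ {N f f′ g g′} → f ≋[ N ] f′ → g ≋[ N ] g′ → f · g ≋[ N ] f′ · g′
  ·-cong-[] p r n n<N =
    ·-cong-≤ n (λ m m≤n → p m (ℕ.≤-<-trans m≤n n<N)) (λ m m≤n → r m (ℕ.≤-<-trans m≤n n<N))

  dilate : Carrier → Coeffs → Coeffs
  dilate x f n = x ^ n * f n

  dilate-cong : ∀ x {f g} → f ≋ g → dilate x f ≋ dilate x g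
  dilate-cong x p n = *-congˡ (p n)

  dilate-+ : ∀ x f g → dilate x (λ n → f n + g n) ≋ (λ n → dilate x f n + dilate x g n)
  dilate-+ x f g n = distribˡ _ _ _

  dilate-· : ∀ x f g → dilate x (f · g) ≋ dilate x f · dilate x g
  dilate-· x f g zero = begin
    1# * (f 0 * g 0)          ≈⟨ *-identityˡ _ ⟩
    f 0 * g 0                 ≈⟨ *-cong (*-identityˡ _) (*-identityˡ _) ⟨
    1# * f 0 * (1# * g 0)     ∎
  dilate-· x f g (suc n) = begin
    x ^ suc n * (f 0 * g (suc n) + (shift f · g) n)
      ≈⟨ distribˡ _ _ _ ⟩
    x ^ suc n * (f 0 * g (suc n)) + x * x ^ n * (shift f · g) n
      ≈⟨ +-cong (x∙yz≈y∙xz* _ _ _) (*-assoc _ _ _) ⟩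
    f 0 * (x ^ suc n * g (suc n)) + x * dilate x (shift f · g) n
      ≈⟨ +-cong (*-congʳ (sym (*-identityˡ _))) (*-congˡ (dilate-· x (shift f) g n)) ⟩
    dilate x f 0 * dilate x g (suc n) + x * (dilate x (shift f) · dilate x g) n
      ≈⟨ +-congˡ (·-scale x (dilate x (shift f)) (dilate x g) n) ⟨
    dilate x f 0 * dilate x g (suc n) + ((λ m → x * dilate x (shift f) m) · dilate x g) n
      ≈⟨ +-congˡ (·-cong (λ m → sym (*-assoc _ _ _)) (λ _ → refl) n) ⟩
    dilate x f 0 * dilate x g (suc n) + (shift (dilate x f) · dilate x g) n ∎
    where open Algebra.Properties.CommutativeSemigroup *-commutativeSemigroup
            using () renaming (x∙yz≈y∙xz to x∙yz≈y∙xz*)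

  dilate-const : ∀ x y → dilate x (const y) ≋ const y
  dilate-const x y zero = *-identityˡ _
  dilate-const x y (suc n) = zeroʳ _

  dilate-X : ∀ x → dilate x X ≋ const x · X
  dilate-X x zero = trans (zeroʳ _) (sym (zeroʳ _))
  dilate-X x (suc zero) = trans (*-congʳ (*-identityʳ _)) (sym (const-· x X 1))
  dilate-X x (suc (suc n)) = trans (zeroʳ _) (sym (trans (const-· x X (suc (suc n))) (zeroʳ _)))

module Evaluate {o ℓ} (R : CommutativeRing o ℓ) where
  open CommutativeRing R hiding (zero)
  open PowerSeries R

  sum-coeff : ∀ n h k → PowerSeries.sum powerSeries n h k ≈ sum n (λ i → h i k)
  sum-coeff zero h k = refl
  sum-coeff (suc n) h k = +-congʳ (sum-coeff n h k)

-- The dilation equation: uniqueness, the even solution K, and its derivation for F.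

module Recurrence {o ℓ} (B : CommutativeRing o ℓ) where
  open CommutativeRing B hiding (zero)
  open Algebra.Properties.Semiring.Exp semiring using (_^_)
  open IntSolver B using (solve; _:=_; _:+_; _:*_; _:-_; con)
  open PowerSeries B
  open Relation.Binary.Reasoning.Setoid setoid
  private
    module Z = CommutativeRing powerSeries
    module EB = Elimination B
    module EZ = Elimination powerSeries

  module Solve
    (q α γ δ : Carrier) (u v : ℕ → Carrier)
    (u-inverse : ∀ n → u n * (1# - q ^ suc n) ≈ 1#)
    (v-inverse : ∀ n → v n * (1# - γ * q ^ suc n) ≈ 1#)
    (q-cancel : ∀ {x y} → q * x ≈ q * y → x ≈ y) where

    η : Coeffs → Coeffs
    η = dilate q

    -- The coefficients in z of (−z;q)_∞ (E), 1/(z;q)_∞ (Q), 1/(z²;q²)_∞ (P), and of the even solution K, for which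
    -- K_{2j} = (−αq;q²)_j (−δq;q²)_j / ((q²;q²)_j (γq;q²)_j). Only the even entries of L matter, since P vanishes at
    -- odd indices.
    E Q P L K : Coeffs
    E zero = 1#
    E (suc n) = E n * q ^ n * u n
    Q zero = 1#
    Q (suc n) = Q n * u n
    P zero = 1#
    P (suc zero) = 0#
    P (suc (suc n)) = P n * u (suc n)
    L zero = 1#
    L (suc zero) = 1#
    L (suc (suc n)) = L n * ((1# + α * q ^ suc n) * (1# + δ * q ^ suc n) * v n)
    K n = L n * P n

    E-equation : E Z.≈ η E Z.+ X Z.* η E
    E-equation zero = sym (trans (+-cong (*-identityˡ _) (X·-zero (η E))) (+-identityʳ _))
    E-equation (suc n) =
      trans (EB.geometric-solve (u-inverse n) (*-congʳ (*-comm _ _))) (+-congˡ (sym (X·-suc (η E) n)))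

    P-equation : P Z.≈ η P Z.+ X Z.* (X Z.* P)
    P-equation zero = sym (trans (+-cong (*-identityˡ _) (X·-zero (X · P))) (+-identityʳ _))
    P-equation (suc zero) =
      sym (trans (+-cong (zeroʳ _) (trans (X·-suc (X · P) 0) (X·-zero P))) (+-identityʳ _))
    P-equation (suc (suc n)) = trans (EB.geometric-solve (u-inverse (suc n)) refl)
      (+-congˡ (sym (trans (X·-suc (X · P) (suc n)) (X·-suc P n))))

    -- The product satisfies s = ηs + zs; on coefficients this reads s_(n+1) (1 - q^(n+1)) = s_n,
    -- the recurrence of `Q`.
    E·P≋Q : E · P ≋ Q
    E·P≋Q zero = *-identityˡ _
    E·P≋Q (suc n) = EB.geometric-unique (u-inverse n) (begin
      (E · P) (suc n)                                ≈⟨ EZ.product-equation E-equation P-equation (suc n) ⟩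
      (η E · η P) (suc n) + (X · (E · P)) (suc n)    ≈⟨ +-cong (sym (dilate-· q E P (suc n))) (X·-suc (E · P) n) ⟩
      q ^ suc n * (E · P) (suc n) + (E · P) n        ≈⟨ +-congˡ (E·P≋Q n) ⟩
      q ^ suc n * (E · P) (suc n) + Q n              ∎)

    η-cong : ∀ {f g} → f ≋ g → η f ≋ η g
    η-cong = dilate-cong q

    η-X· : ∀ f → η (X Z.* f) Z.≈ const q Z.* (X Z.* η f)
    η-X· f = Z.trans (dilate-· q X f) (Z.trans (Z.*-congʳ {η f} (dilate-X q)) (Z.*-assoc (const q) X (η f)))

    η-const· : ∀ x f → η (const x Z.* f) Z.≈ const x Z.* η f
    η-const· x f = Z.trans (dilate-· q (const x) f) (Z.*-congʳ {η f} (dilate-const q x))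

    const+const-· : ∀ x y f → (const x Z.+ const y) · f ≋ (λ n → (x + y) * f n)
    const+const-· x y f n = trans (·-distribʳ f (const x) (const y) n)
      (trans (+-cong (const-· x f n) (const-· y f n)) (sym (distribʳ _ _ _)))

    const·const-· : ∀ x y f → (const x · const y) · f ≋ (λ n → x * y * f n)
    const·const-· x y f n = trans (·-assoc (const x) (const y) f n)
      (trans (const-· x (const y · f) n) (trans (*-congˡ (const-· y f n)) (sym (*-assoc _ _ _))))

    DilationEquation : Coeffs → Set ℓ
    DilationEquation s = const q Z.* s Z.+ const γ Z.* η (η s) Z.≈
      (const q Z.+ const γ) Z.* η s Z.+
        X Z.* EZ.Ψ (const q) (const α) (const γ) (const δ) X s (η s) (η (η s))

    dilationEquation-coeff : ∀ {s} → DilationEquation s → ∀ n →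
      q * s (suc n) + γ * (q ^ suc n * (q ^ suc n * s (suc n))) ≈
      (q + γ) * (q ^ suc n * s (suc n)) + EZ.Ψ (const q) (const α) (const γ) (const δ) X s (η s) (η (η s)) n
    dilationEquation-coeff {s} eq n = begin
      q * s (suc n) + γ * (q ^ suc n * (q ^ suc n * s (suc n)))
        ≈⟨ +-cong (const-· q s (suc n)) (const-· γ (η (η s)) (suc n)) ⟨
      (const q · s) (suc n) + (const γ · η (η s)) (suc n)
        ≈⟨ eq (suc n) ⟩
      ((const q Z.+ const γ) · η s) (suc n) + (X · Ψs) (suc n)
        ≈⟨ +-cong (const+const-· q γ (η s) (suc n)) (X·-suc Ψs n) ⟩
      (q + γ) * (q ^ suc n * s (suc n)) + Ψs n ∎
      where
      Ψs : Coeffs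
      Ψs = EZ.Ψ (const q) (const α) (const γ) (const δ) X s (η s) (η (η s))

    -- At index 0 the equation says nothing, and at index 1 its leading factor is q(1 - q)(1 - γ),
    -- where 1 - γ is not covered by the given inverses; so both values are prescribed. From index 2
    -- on each coefficient is determined by the earlier ones.
    dilationEquation-unique : ∀ {s t} → DilationEquation s → DilationEquation t →
                              s 0 ≈ t 0 → s 1 ≈ t 1 → s ≋ t
    dilationEquation-unique {s} {t} eqs eqt p₀ p₁ n = below (suc n) n ℕ.≤-refl
      where
      Ψ′ : Coeffs → Coeffs
      Ψ′ f = EZ.Ψ (const q) (const α) (const γ) (const δ) X f (η f) (η (η f))

      Ψ-cong : ∀ {N} → s ≋[ N ] t → Ψ′ s ≋[ N ] Ψ′ t
      Ψ-cong {N} p n n<N = +-cong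
        (+-cong
          (+-cong (times (const q) p n n<N)
                  (times ((const α Z.+ const δ) Z.* const q Z.* const q) (times X ηp) n n<N))
          (-‿cong (times (const q Z.* const γ) ηηp n n<N)))
        (times (const α Z.* const δ Z.* const q Z.* const q Z.* const q)
          (λ m m<N → +-cong (times X ηηp m m<N) (times (const q) (times X (times X ηηp)) m m<N)) n n<N)
        where
        times : ∀ h {f f′} → f ≋[ N ] f′ → h · f ≋[ N ] h · f′
        times h r = ·-cong-[] (λ _ _ → refl) r
        ηp : η s ≋[ N ] η t
        ηp m m<N = *-congˡ (p m m<N)
        ηηp : η (η s) ≋[ N ] η (η t)
        ηηp m m<N = *-congˡ (ηp m m<N)

      at : ∀ N → s ≋[ N ] t → s N ≈ t N
      at zero p = p₀
      at (suc zero) p = p₁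
      -- Here x = q^(n+2) and y = q^(n+1), so `u (suc n)` inverts 1 - x and `v n` inverts 1 - γy.
      at (suc (suc n)) p = EB.indicial-cancel q-cancel (u-inverse (suc n)) (v-inverse n) refl
        (dilationEquation-coeff eqs (suc n))
        (trans (dilationEquation-coeff eqt (suc n)) (+-congˡ (sym (Ψ-cong p (suc n) ℕ.≤-refl))))

      below : ∀ N → s ≋[ N ] t
      below (suc N) n n<1+N with ℕ.m<1+n⇒m<n∨m≡n n<1+N
      ... | inj₁ n<N = below N n n<N
      ... | inj₂ ≡.refl = at N (below N)

    -- At index n + 2 this is q(1 - q^(n+2))(1 - γq^(n+1)) K_(n+2) = q(1 + αq^(n+1))(1 + δq^(n+1))
    -- K_n, the recurrence built into `L` and `P`. Index 0 is an identity, and index 1 holds because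
    -- `P 1` is 0.
    K-equation : const q Z.* K Z.+ const γ Z.* η (η K) Z.≈ (const q Z.+ const γ) Z.* η K Z.+
      X Z.* (X Z.* (const q Z.* K Z.+ (const α Z.+ const δ) Z.* const q Z.* const q Z.* η K
                    Z.+ const α Z.* const δ Z.* const q Z.* const q Z.* const q Z.* η (η K)))
    K-equation n = trans (+-cong (const-· q K n) (const-· γ (η (η K)) n)) (trans (coeff n)
      (+-congʳ (sym (const+const-· q γ (η K) n))))
      where
      W : Coeffs
      W = const q Z.* K Z.+ (const α Z.+ const δ) Z.* const q Z.* const q Z.* η K
          Z.+ const α Z.* const δ Z.* const q Z.* const q Z.* const q Z.* η (η K)

      W-coeff : ∀ n → W n ≈ q * K n + (α + δ) * q * q * (q ^ n * K n) + α * δ * q * q * q * (q ^ n * (q ^ n * K n))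
      W-coeff n = +-cong (+-cong (const-· q K n) (trans (Z.*-congʳ {η K} ad₂ n) (const-· _ (η K) n)))
                         (trans (Z.*-congʳ {η (η K)} ad₃ n) (const-· _ (η (η K)) n))
        where
        const-* : ∀ x y → const x · const y ≋ const (x * y)
        const-* x y n = trans (const-· x (const y) n) (lem n)
          where
          lem : ∀ n → x * const y n ≈ const (x * y) n
          lem zero = refl
          lem (suc n) = zeroʳ _
        const-+ : const α Z.+ const δ Z.≈ const (α + δ)
        const-+ zero = refl
        const-+ (suc n) = +-identityˡ _
        times : ∀ {f x} y → f ≋ const x → f · const y ≋ const (x * y)
        times {f} {x} y p = Z.trans (Z.*-congʳ {const y} p) (const-* x y)
        ad₂ : (const α Z.+ const δ) Z.* const q Z.* const q Z.≈ const ((α + δ) * q * q)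
        ad₂ = times q (times q const-+)
        ad₃ : const α Z.* const δ Z.* const q Z.* const q Z.* const q Z.≈ const (α * δ * q * q * q)
        ad₃ = times q (times q (times q (const-* α δ)))

      coeff : ∀ n → q * K n + γ * (q ^ n * (q ^ n * K n)) ≈ (q + γ) * (q ^ n * K n) + (X · (X · W)) n
      coeff zero = trans (solve 3 (λ q γ k → q :* k :+ γ :* (con (ℤ.+ 1) :* (con (ℤ.+ 1) :* k))
        := (q :+ γ) :* (con (ℤ.+ 1) :* k) :+ con (ℤ.+ 0)) refl q γ (K 0)) (+-congˡ (sym (X·-zero (X · W))))
      coeff (suc zero) = trans (solve 4 (λ q γ x k → q :* (k :* con (ℤ.+ 0)) :+ γ :* (x :* (x :* (k :* con (ℤ.+ 0))))
        := (q :+ γ) :* (x :* (k :* con (ℤ.+ 0))) :+ con (ℤ.+ 0)) refl q γ (q ^ 1) (L 1))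
        (+-congˡ (sym (trans (X·-suc (X · W) 0) (X·-zero W))))
      coeff (suc (suc n)) = trans
        (EB.indicial-solve (u-inverse (suc n)) (v-inverse n) refl
          (solve 5 (λ l p s v u → l :* (s :* v) :* (p :* u) := l :* p :* (s :* v :* u)) refl
            (L n) (P n) ((1# + α * q ^ suc n) * (1# + δ * q ^ suc n)) (v n) (u (suc n))))
        (+-congˡ (sym (trans (X·-suc (X · W) (suc n)) (trans (X·-suc W n) (W-coeff n)))))

    E·K-equation : DilationEquation (E · K)
    E·K-equation = Z.trans (Z.+-congˡ {const q Z.* (E Z.* K)} (Z.*-congˡ {const γ} ηη))
      (Z.trans (EZ.dilation-equation-product E-equation ηE-equation K-equation)
        (Z.+-cong (Z.*-congˡ {const q Z.+ const γ} (Z.sym η¹)) (Z.*-congˡ {X}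
          (Z.+-cong (Z.+-cong (Z.+-congˡ {const q Z.* (E Z.* K)}
              (Z.*-congˡ {(const α Z.+ const δ) Z.* const q Z.* const q} (Z.*-congˡ {X} (Z.sym η¹))))
              (Z.-‿cong (Z.*-congˡ {const q Z.* const γ} (Z.sym ηη))))
            (Z.*-congˡ {const α Z.* const δ Z.* const q Z.* const q Z.* const q}
              (Z.+-cong (Z.*-congˡ {X} (Z.sym ηη)) (Z.*-congˡ {const q} (Z.*-congˡ {X} (Z.*-congˡ {X} (Z.sym ηη))))))))))
      where
      η¹ : η (E Z.* K) Z.≈ η E Z.* η K
      η¹ = dilate-· q E K
      ηη : η (η (E Z.* K)) Z.≈ η (η E) Z.* η (η K)
      ηη = Z.trans (η-cong η¹) (dilate-· q (η E) (η K))
      ηE-equation : η E Z.≈ η (η E) Z.+ const q Z.* (X Z.* η (η E))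
      ηE-equation = Z.trans (η-cong E-equation) (Z.trans (dilate-+ q (η E) (X · η E)) (Z.+-congˡ {η (η E)} (η-X· (η E))))

    module Solution (F V : ℕ → Carrier) (F₀ : F 0 ≈ 1#) (V₀ : V 0 ≈ 0#) (F₁ : F 1 ≈ q ^ 1 * F 1 + F 0)
      (F-step : ∀ n → F (suc (suc n)) ≈
        q ^ (suc (suc n)) * F (suc (suc n)) + F (suc n) + (γ + δ) * (q ^ suc n * V (suc n)) + α * q * (q ^ n * F n))
      (V-step : ∀ n → V (suc n) + q ^ suc n * F (suc n) + δ * (q ^ n * V n) ≈
        F (suc n) + α * q * (q ^ n * F n) + γ * (q ^ suc n * V (suc n))) where

      F-equation : F Z.≈ η F Z.+ X Z.* F Z.+ (const γ Z.+ const δ) Z.* (X Z.* η V)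
                         Z.+ const α Z.* const q Z.* (X Z.* (X Z.* η F))
      F-equation n = trans (coeff n) (+-cong (+-congˡ (sym (const+const-· γ δ (X · η V) n)))
                                             (sym (const·const-· α q (X · (X · η F)) n)))
        where
        coeff : ∀ n → F n ≈ q ^ n * F n + (X · F) n + (γ + δ) * (X · η V) n + α * q * (X · (X · η F)) n
        coeff zero = trans (solve 4 (λ f γ δ e → f := con (ℤ.+ 1) :* f :+ con (ℤ.+ 0) :+ (γ :+ δ) :* con (ℤ.+ 0)
            :+ e :* con (ℤ.+ 0)) refl (F 0) γ δ (α * q))
          (+-cong (+-cong (+-congˡ (sym (X·-zero F))) (*-congˡ (sym (X·-zero (η V))))) (*-congˡ (sym (X·-zero (X · η F)))))
        -- At index 1 the term z·ηV contributes `V 0`; its vanishing brings `F₁` into the pattern of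
        -- `F-step`.
        coeff (suc zero) = trans F₁ (trans
          (solve 5 (λ f g γ δ e → f :+ g := f :+ g :+ (γ :+ δ) :* (con (ℤ.+ 1) :* con (ℤ.+ 0)) :+ e :* con (ℤ.+ 0))
            refl (q ^ 1 * F 1) (F 0) γ δ (α * q))
          (+-cong (+-cong (+-congˡ (sym (X·-suc F 0))) (*-congˡ (sym (trans (X·-suc (η V) 0) (*-congˡ V₀)))))
            (*-congˡ (sym (trans (X·-suc (X · η F) 0) (X·-zero (η F)))))))
        coeff (suc (suc n)) = trans (F-step n)
          (+-cong (+-cong (+-congˡ (sym (X·-suc F (suc n)))) (*-congˡ (sym (X·-suc (η V) (suc n)))))
            (*-congˡ (sym (trans (X·-suc (X · η F) (suc n)) (X·-suc (η F) n)))))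

      V-equation : V Z.+ η F Z.+ const δ Z.* (X Z.* η V) Z.≈
                   F Z.+ const α Z.* const q Z.* (X Z.* η F) Z.+ const γ Z.* η V
      V-equation n = trans (+-congˡ (const-· δ (X · η V) n)) (trans (coeff n)
        (sym (+-cong (+-congˡ (const·const-· α q (X · η F) n)) (const-· γ (η V) n))))
        where
        coeff : ∀ n → V n + q ^ n * F n + δ * (X · η V) n ≈ F n + α * q * (X · η F) n + γ * (q ^ n * V n)
        coeff zero = trans (+-cong (+-congʳ V₀) (*-congˡ (X·-zero (η V)))) (trans
          (solve 4 (λ f γ δ e → con (ℤ.+ 0) :+ con (ℤ.+ 1) :* f :+ δ :* con (ℤ.+ 0)
              := f :+ e :* con (ℤ.+ 0) :+ γ :* (con (ℤ.+ 1) :* con (ℤ.+ 0))) refl (F 0) γ δ (α * q))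
          (sym (+-cong (+-congˡ (*-congˡ (X·-zero (η F)))) (*-congˡ (*-congˡ V₀)))))
        coeff (suc n) = trans (+-congˡ (*-congˡ (X·-suc (η V) n)))
          (trans (V-step n) (+-congʳ (+-congˡ (*-congˡ (sym (X·-suc (η F) n))))))

      F-dilationEquation : DilationEquation F
      F-dilationEquation = EZ.dilation-equation-eliminate F-equation ηV-equation ηF-equation
        where
        η-const₂· : ∀ x y f → η (const x Z.* const y Z.* f) Z.≈ const x Z.* const y Z.* η f
        η-const₂· x y f = Z.trans (dilate-· q (const x · const y) f) (Z.*-congʳ {η f}
          (Z.trans (dilate-· q (const x) (const y)) (Z.*-cong (dilate-const q x) (dilate-const q y))))
        η-const₊· : ∀ x y f → η ((const x Z.+ const y) Z.* f) Z.≈ (const x Z.+ const y) Z.* η f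
        η-const₊· x y f = Z.trans (dilate-· q (const x Z.+ const y) f) (Z.*-congʳ {η f}
          (Z.trans (dilate-+ q (const x) (const y)) (Z.+-cong (dilate-const q x) (dilate-const q y))))

        η-+ : ∀ f {f′} g {g′} → η f Z.≈ f′ → η g Z.≈ g′ → η (f Z.+ g) Z.≈ f′ Z.+ g′
        η-+ f g p r = Z.trans (dilate-+ q f g) (Z.+-cong p r)

        ηV-equation : η V Z.+ η (η F) Z.+ const δ Z.* (const q Z.* (X Z.* η (η V))) Z.≈
          η F Z.+ const α Z.* const q Z.* (const q Z.* (X Z.* η (η F))) Z.+ const γ Z.* η (η V)
        ηV-equation = Z.trans (Z.sym left) (Z.trans (η-cong V-equation) right)
          where
          left : η (V Z.+ η F Z.+ const δ Z.* (X Z.* η V)) Z.≈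
                 η V Z.+ η (η F) Z.+ const δ Z.* (const q Z.* (X Z.* η (η V)))
          left = η-+ (V Z.+ η F) (const δ · (X · η V)) (η-+ V (η F) Z.refl Z.refl)
            (Z.trans (η-const· δ (X · η V)) (Z.*-congˡ {const δ} (η-X· (η V))))
          right : η (F Z.+ const α Z.* const q Z.* (X Z.* η F) Z.+ const γ Z.* η V) Z.≈
                  η F Z.+ const α Z.* const q Z.* (const q Z.* (X Z.* η (η F))) Z.+ const γ Z.* η (η V)
          right = η-+ (F Z.+ const α Z.* const q Z.* (X Z.* η F)) (const γ · η V)
            (η-+ F (const α Z.* const q Z.* (X Z.* η F)) Z.refl
              (Z.trans (η-const₂· α q (X · η F)) (Z.*-congˡ {const α Z.* const q} (η-X· (η F)))))
            (η-const· γ (η V))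

        ηF-equation : η F Z.≈ η (η F) Z.+ const q Z.* (X Z.* η F)
          Z.+ (const γ Z.+ const δ) Z.* (const q Z.* (X Z.* η (η V)))
          Z.+ const α Z.* const q Z.* (const q Z.* (X Z.* (const q Z.* (X Z.* η (η F)))))
        ηF-equation = Z.trans (η-cong F-equation)
          (η-+ (η F Z.+ X Z.* F Z.+ (const γ Z.+ const δ) Z.* (X Z.* η V)) (const α Z.* const q Z.* (X Z.* (X Z.* η F)))
            (η-+ (η F Z.+ X Z.* F) ((const γ Z.+ const δ) Z.* (X Z.* η V))
              (η-+ (η F) (X Z.* F) Z.refl (η-X· F))
              (Z.trans (η-const₊· γ δ (X · η V)) (Z.*-congˡ {const γ Z.+ const δ} (η-X· (η V)))))
            (Z.trans (η-const₂· α q (X · (X · η F))) (Z.*-congˡ {const α Z.* const q}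
              (Z.trans (η-X· (X · η F)) (Z.*-congˡ {const q} (Z.*-congˡ {X} (η-X· (η F))))))))

      F≋E·K : F ≋ E · K
      F≋E·K = dilationEquation-unique F-dilationEquation E·K-equation
        (trans F₀ (sym (trans (*-identityˡ _) (*-identityˡ _))))
        -- `F₁` forces F 1 = u 0. Since K 1 = 0, coefficient 1 of E·K is E 1 · K 0, which is also u
        -- 0.
        (trans (EB.geometric-unique (u-inverse 0) F₁) (trans (*-congʳ F₀)
          (solve 1 (λ u → con (ℤ.+ 1) :* u := con (ℤ.+ 1) :* (con (ℤ.+ 1) :* con (ℤ.+ 0))
             :+ con (ℤ.+ 1) :* con (ℤ.+ 1) :* u :* (con (ℤ.+ 1) :* con (ℤ.+ 1))) refl (u 0))))

-- The q-adic limit; here `X` is q, and `PB` is the ring of series in z over it.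

module Limit {o ℓ} (R : CommutativeRing o ℓ) where
  open PowerSeries R
  private
    module R = CommutativeRing R
    module PB = PowerSeries powerSeries
  open CommutativeRing powerSeries hiding (zero)
  open Algebra.Properties.Semiring.Exp semiring using (_^_)
  open IntSolver powerSeries using (solve; _:=_; _:+_; _:*_; _:-_; con)

  ≋[]-refl : ∀ {N f} → f ≋[ N ] f
  ≋[]-refl n n<N = R.refl

  ≋[]-trans : ∀ {N f g h} → f ≋[ N ] g → g ≋[ N ] h → f ≋[ N ] h
  ≋[]-trans p r n n<N = R.trans (p n n<N) (r n n<N)

  ≋[]-sym : ∀ {N f g} → f ≋[ N ] g → g ≋[ N ] f
  ≋[]-sym p n n<N = R.sym (p n n<N)

  ≋⇒≋[] : ∀ {N f g} → f ≋ g → f ≋[ N ] g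
  ≋⇒≋[] p n n<N = p n

  ≋[]-weaken : ∀ {M N f g} → M ≤ N → f ≋[ N ] g → f ≋[ M ] g
  ≋[]-weaken M≤N p n n<M = p n (ℕ.<-≤-trans n<M M≤N)

  +-cong-[] : ∀ {N f f′ g g′} → f ≋[ N ] f′ → g ≋[ N ] g′ → f + g ≋[ N ] f′ + g′
  +-cong-[] p r n n<N = R.+-cong (p n n<N) (r n n<N)

  ·-zeroʳ-[] : ∀ {N} f {g} → g ≋[ N ] 0# → f * g ≋[ N ] 0#
  ·-zeroʳ-[] f p = ≋[]-trans (·-cong-[] (≋[]-refl {f = f}) p) (≋⇒≋[] (zeroʳ f))

  ·-one-[] : ∀ {N f g h} → f ≋[ N ] h → g ≋[ N ] 1# → f * g ≋[ N ] h
  ·-one-[] {h = h} p r = ≋[]-trans (·-cong-[] p r) (≋⇒≋[] (*-identityʳ h))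

  ·-valuation : ∀ {N x f} → x 0 R.≈ R.0# → f ≋[ N ] 0# → x * f ≋[ suc N ] 0#
  ·-valuation {f = f} x₀ p zero n<N = R.trans (R.*-congʳ x₀) (R.zeroˡ _)
  ·-valuation {x = x} {f} x₀ p (suc n) (s≤s n<N) = R.trans
    (R.+-cong (R.trans (R.*-congʳ x₀) (R.zeroˡ _)) (·-zeroʳ-[] (shift x) p n n<N)) (R.+-identityˡ _)

  ^-valuation : ∀ {x} → x 0 R.≈ R.0# → ∀ n → x ^ n ≋[ n ] 0#
  ^-valuation x₀ (suc n) = ·-valuation x₀ (^-valuation x₀ n)

  X^-valuation : ∀ n → X ^ n ≋[ n ] 0#
  X^-valuation = ^-valuation R.refl

  ·X^-valuation : ∀ f n → f * X ^ n ≋[ n ] 0#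
  ·X^-valuation f n = ·-zeroʳ-[] f (X^-valuation n)

  ·X^-zero : ∀ f n → (f * X ^ suc n) 0 R.≈ R.0#
  ·X^-zero f n = ·X^-valuation f (suc n) 0 (s≤s z≤n)

  partialGeometric : Coeffs → ℕ → Coeffs
  partialGeometric x n = PB.sum n (x ^_)

  geometric : Coeffs → Coeffs
  geometric x n = partialGeometric x n n

  partialGeometric-inverse : ∀ x n → partialGeometric x n * (1# - x) ≈ 1# - x ^ suc n
  partialGeometric-inverse x zero =
    solve 1 (λ x → con (ℤ.+ 1) :* (con (ℤ.+ 1) :- x) := con (ℤ.+ 1) :- x :* con (ℤ.+ 1)) refl x
  partialGeometric-inverse x (suc n) = trans (distribʳ (1# - x) (partialGeometric x n) (x ^ suc n))
    (trans (+-congʳ {x ^ suc n * (1# - x)} (partialGeometric-inverse x n))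
      (solve 2 (λ x y → con (ℤ.+ 1) :- y :+ y :* (con (ℤ.+ 1) :- x) := con (ℤ.+ 1) :- x :* y) refl x (x ^ suc n)))

  -- The common convergence argument for partial geometric sums, partial products and the
  -- coefficients of `Q`.
  stabilise : (S : ℕ → Coeffs) → (∀ n → S (suc n) ≋[ suc n ] S n) → ∀ {m n} → m ≤ n → S n ≋[ suc m ] S m
  stabilise S step {m} m≤n = go (ℕ.≤⇒≤′ m≤n)
    where
    go : ∀ {n} → m ℕ.≤′ n → S n ≋[ suc m ] S m
    go (ℕ.≤′-reflexive ≡.refl) = ≋[]-refl
    go {suc n} (ℕ.≤′-step m≤n) = ≋[]-trans (≋[]-weaken (s≤s (ℕ.≤′⇒≤ m≤n)) (step n)) (go m≤n)

  -- Up to index n the diagonal agrees with the n-th partial sum, for which the product telescopes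
  -- to 1 - x^(n+1), and this is 1 at indices up to n.
  geometric-inverse : ∀ {x} → x 0 R.≈ R.0# → geometric x * (1# - x) ≈ 1#
  geometric-inverse {x} x₀ n = R.trans
    (·-cong-≤ n (λ m m≤n → R.sym (stabilise (partialGeometric x) step m≤n m ℕ.≤-refl)) (λ _ _ → R.refl))
    (R.trans (partialGeometric-inverse x n n) (1-x≋1 n ℕ.≤-refl))
    where
    step : ∀ n → partialGeometric x (suc n) ≋[ suc n ] partialGeometric x n
    step n = ≋[]-trans (+-cong-[] (≋[]-refl {f = partialGeometric x n}) (^-valuation x₀ (suc n)))
      (≋⇒≋[] (+-identityʳ (partialGeometric x n)))
    1-x≋1 : (1# - x ^ suc n) ≋[ suc n ] 1#
    1-x≋1 m m<n = R.trans (R.+-congˡ (R.trans (R.-‿cong (^-valuation x₀ (suc n) m m<n)) -0#≈0#)) (R.+-identityʳ _)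
      where open Algebra.Properties.Ring R.ring using (-0#≈0#)

  geometric-valuation : ∀ {N x} → x ≋[ suc N ] 0# → geometric x ≋[ suc N ] 1#
  geometric-valuation {N} {x} p = ≋[]-trans (≋⇒≋[] expand)
    (≋[]-trans (+-cong-[] (≋[]-refl {f = 1#}) (·-zeroʳ-[] (geometric x) p)) (≋⇒≋[] (+-identityʳ 1#)))
    where
    expand : geometric x ≈ 1# + geometric x * x
    expand = trans (solve 2 (λ g x → g := g :* (con (ℤ.+ 1) :- x) :+ g :* x) refl (geometric x) x)
      (+-congʳ {geometric x * x} (geometric-inverse (p 0 (s≤s z≤n))))

  onePlus : Coeffs → ℕ → Coeffs
  onePlus x n = 1# + x * X ^ suc n

  onePlus-intro : ∀ {f g} x n → f ≈ 1# → g ≈ x * X ^ suc n → f + g ≈ onePlus x n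
  onePlus-intro x n p r = +-cong p r

  onePlus-valuation : ∀ x n → onePlus x n ≋[ suc n ] 1#
  onePlus-valuation x n = ≋[]-trans (+-cong-[] (≋[]-refl {f = 1#}) (·X^-valuation x (suc n))) (≋⇒≋[] (+-identityʳ 1#))

  product : ℕ → (ℕ → Coeffs) → Coeffs
  product zero F = F 0
  product (suc n) F = product n F * F (suc n)

  product∞ : (ℕ → Coeffs) → Coeffs
  product∞ F n = product n F n

  product∞-≋[] : ∀ {F} → (∀ j → F j ≋[ j ] 1#) → ∀ n → product∞ F ≋[ suc n ] product n F
  product∞-≋[] {F} p n m (s≤s m≤n) = R.sym (stabilise (λ n → product n F)
    (λ n → ·-one-[] (≋[]-refl {f = product n F}) (p (suc n))) m≤n m ℕ.≤-refl)

  -- The hypothesis concerns the products, not g alone: where `g` and `g′` are not yet close, a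
  -- small factor `f j` may compensate.
  PB-·-cong-[] : ∀ {N} k {f g g′} → (∀ j → j ≤ k → f j * g (k ∸ j) ≋[ N ] f j * g′ (k ∸ j)) →
                 (f PB.· g) k ≋[ N ] (f PB.· g′) k
  PB-·-cong-[] zero p = p 0 z≤n
  PB-·-cong-[] (suc k) p = +-cong-[] (p 0 z≤n) (PB-·-cong-[] k (λ j j≤k → p (suc j) (s≤s j≤k)))

  -- In this form `L (double (suc n))` unfolds by one double step of the recurrence.
  double : ℕ → ℕ
  double zero = zero
  double (suc n) = suc (suc (double n))

  n≤double : ∀ n → n ≤ double n
  n≤double zero = z≤n
  n≤double (suc n) = s≤s (ℕ.m≤n⇒m≤1+n (n≤double n))

  module _ (α γ δ : R.Carrier) where
    u v : ℕ → Coeffs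
    u n = geometric (X ^ suc n)
    v n = geometric (const γ * X ^ suc n)

    X-cancel : ∀ {x y} → X * x ≈ X * y → x ≈ y
    X-cancel {x} {y} p n = R.trans (R.sym (X·-suc x n)) (R.trans (p (suc n)) (X·-suc y n))

    open Recurrence.Solve powerSeries X (const α) (const γ) (const δ) u v
      (λ n → geometric-inverse (X^-valuation (suc n) 0 (s≤s z≤n))) (λ n → geometric-inverse (·X^-zero (const γ) n)) X-cancel
      public using (E; Q; P; L; K; E·P≋Q; module Solution)

    u-valuation : ∀ n → u n ≋[ suc n ] 1#
    u-valuation n = geometric-valuation (X^-valuation (suc n))

    v-valuation : ∀ n → v n ≋[ suc n ] 1#
    v-valuation n = geometric-valuation (·X^-valuation (const γ) (suc n))

    -- The exact q-valuation is n(n+1)/2; the last factor q^n alone is enough for the limit.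
    E-valuation : ∀ n → E (suc n) ≋[ n ] 0#
    E-valuation n = ≋[]-trans (≋⇒≋[] (*-comm (E n * X ^ n) (u n)))
      (·-zeroʳ-[] (u n) (·X^-valuation (E n) n))

    P-odd : ∀ n → P (suc (double n)) ≈ 0#
    P-odd zero = refl
    P-odd (suc n) = trans (*-congʳ {u (suc (suc (double n)))} (P-odd n)) (zeroˡ (u (suc (suc (double n)))))

    L-even : ∀ n → L (double (suc n)) ≈
      product n (λ j → onePlus (const α) (double j)) * product n (λ j → onePlus (const δ) (double j)) * product n (λ j → v (double j))
    L-even zero = *-identityˡ _
    L-even (suc n) = trans (*-congʳ {onePlus (const α) (double (suc n)) * onePlus (const δ) (double (suc n)) * v (double (suc n))} (L-even n))
      (solve 6 (λ p r s x y z → p :* r :* s :* (x :* y :* z) := p :* x :* (r :* y) :* (s :* z)) refl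
        (product n (λ j → onePlus (const α) (double j))) (product n (λ j → onePlus (const δ) (double j))) (product n (λ j → v (double j)))
        (onePlus (const α) (double (suc n))) (onePlus (const δ) (double (suc n))) (v (double (suc n))))

    Q-product : ∀ n → Q (suc n) ≈ product n u
    Q-product zero = *-identityˡ (u 0)
    Q-product (suc n) = *-congʳ {u (suc n)} (Q-product n)

    -- Beyond index 2n every further factor of `L` is 1 modulo q^n. The induction on t goes in steps
    -- of two; at odd indices both sides vanish with `P`.
    K-limit : ∀ n t → K (t ℕ.+ double n) ≋[ n ] L (double n) * P (t ℕ.+ double n)
    K-limit n zero = ≋[]-refl
    K-limit n (suc zero) = ≋⇒≋[] (trans (vanish (L (suc (double n)))) (sym (vanish (L (double n)))))
      where
      vanish : ∀ x → x * P (suc (double n)) ≈ 0#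
      vanish x = trans (*-congˡ {x} (P-odd n)) (zeroʳ x)
    K-limit n (suc (suc t)) = ≋[]-trans (≋⇒≋[] regroup)
      (≋[]-trans (·-one-[] (·-cong-[] (K-limit n t) (≋[]-refl {f = u (suc m)})) factors)
        (≋⇒≋[] (*-assoc (L (double n)) (P m) (u (suc m)))))
      where
      m : ℕ
      m = t ℕ.+ double n
      n≤1+m : n ≤ suc m
      n≤1+m = ℕ.m≤n⇒m≤1+n (ℕ.≤-trans (n≤double n) (ℕ.m≤n+m (double n) t))
      factors : onePlus (const α) m * onePlus (const δ) m * v m ≋[ n ] 1#
      factors = ≋[]-weaken n≤1+m
        (·-one-[] (·-one-[] (onePlus-valuation (const α) m) (onePlus-valuation (const δ) m)) (v-valuation m))
      regroup : K (suc (suc m)) ≈ K m * u (suc m) * (onePlus (const α) m * onePlus (const δ) m * v m)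
      regroup = solve 4 (λ l p u s → l :* s :* (p :* u) := l :* p :* u :* s) refl
        (L m) (P m) (u (suc m)) (onePlus (const α) m * onePlus (const δ) m * v m)

    -- For j ≤ n the index k - j is at least 2n, so `K` may be replaced by its limit form; for j > n
    -- the factor `E j` kills both sides modulo q^n. This is where the bound 3n comes from. The
    -- constant `L (double n)` then factors out of E·P, which is Q.
    E·K-limit : ∀ n k → n ℕ.+ double n ≤ k → (E PB.· K) k ≋[ n ] L (double n) * Q k
    E·K-limit n k n+2n≤k = ≋[]-trans (PB-·-cong-[] k term)
      (≋⇒≋[] (trans (swap k) (*-congˡ {L (double n)} (E·P≋Q k))))
      where
      term : ∀ j → j ≤ k → E j * K (k ∸ j) ≋[ n ] E j * (L (double n) * P (k ∸ j))
      term j j≤k with ℕ.≤-<-connex j n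
      ... | inj₁ j≤n = ·-cong-[] (≋[]-refl {f = E j})
        (≡.subst (λ i → K i ≋[ n ] L (double n) * P i) (ℕ.m∸n+n≡m 2n≤k-j) (K-limit n (k ∸ j ∸ double n)))
        where
        2n≤k-j : double n ≤ k ∸ j
        2n≤k-j = ℕ.m+n≤o⇒m≤o∸n (double n) (ℕ.≤-trans (ℕ.≤-reflexive (ℕ.+-comm (double n) j))
          (ℕ.≤-trans (ℕ.+-monoˡ-≤ (double n) j≤n) n+2n≤k))
      term (suc j) j≤k | inj₂ (s≤s n≤j) = ≋[]-trans (vanish (K (k ∸ suc j)))
        (≋[]-sym (vanish (L (double n) * P (k ∸ suc j))))
        where
        vanish : ∀ x → E (suc j) * x ≋[ n ] 0#
        vanish x = ≋[]-trans (≋⇒≋[] (*-comm (E (suc j)) x)) (·-zeroʳ-[] x (≋[]-weaken n≤j (E-valuation j)))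
      swap : ∀ k → (E PB.· (λ i → L (double n) * P i)) k ≈ L (double n) * (E PB.· P) k
      swap k = trans (PB.·-comm E (λ i → L (double n) * P i) k) (trans (PB.·-scale (L (double n)) P E k)
        (*-congˡ {L (double n)} (PB.·-comm P E k)))

    E·K-coefficient : ∀ n k → suc n ℕ.+ double (suc n) ≤ k → (E PB.· K) k n R.≈
      (product∞ (λ j → onePlus (const α) (double j)) * product∞ (λ j → onePlus (const δ) (double j)) * product∞ u
        * product∞ (λ j → v (double j))) n
    E·K-coefficient n k large = ≋[]-trans (E·K-limit (suc n) k large)
      (≋[]-trans (·-cong-[] (≋⇒≋[] (L-even n)) (≋[]-trans Q-limit (≋⇒≋[] (Q-product n))))
        (≋[]-trans (≋⇒≋[] (solve 4 (λ x y z w → x :* y :* z :* w := x :* y :* w :* z) refl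
            (product n (λ j → onePlus (const α) (double j))) (product n (λ j → onePlus (const δ) (double j)))
            (product n (λ j → v (double j))) (product n u)))
          (≋[]-sym (·-cong-[] (·-cong-[] (·-cong-[]
            (product∞-≋[] (λ j → even (onePlus-valuation (const α) (double j))) n)
            (product∞-≋[] (λ j → even (onePlus-valuation (const δ) (double j))) n))
            (product∞-≋[] (λ j → ≋[]-weaken (ℕ.n≤1+n j) (u-valuation j)) n))
            (product∞-≋[] (λ j → even (v-valuation (double j))) n)))))
      n ℕ.≤-refl
      where
      even : ∀ {j f} → f ≋[ suc (double j) ] 1# → f ≋[ j ] 1#
      even {j} = ≋[]-weaken (ℕ.m≤n⇒m≤1+n (n≤double j))
      Q-limit : Q k ≋[ suc n ] Q (suc n)
      Q-limit = ≋[]-weaken (ℕ.n≤1+n (suc n)) (stabilise Q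
        (λ m → ·-one-[] (≋[]-refl {f = Q m}) (u-valuation m)) (ℕ.≤-trans (ℕ.m≤m+n (suc n) (double (suc n))) large))

-- The linear recurrences forced by the difference matrix.

module Tails {o ℓ} (B : CommutativeRing o ℓ) where
  open CommutativeRing B hiding (zero)
  open Algebra.Properties.Semiring.Exp semiring using (_^_)
  open IntSolver B using (solve; _:=_; _:+_; _:*_; con)
  open Relation.Binary.Reasoning.Setoid setoid

  -- `S x j` stands for the series of lists that may follow the part j of colour x, and `H y j` for
  -- that of nonempty lists headed by a part of colour y and value between 1 and j. Truncated
  -- subtraction is harmless since `H y 0` vanishes.
  module System
    (q : Carrier) (ω : Colour → Carrier) (ω-b : ω b ≈ 1#) (S H : Colour → ℕ → Carrier)
    (S-equation : ∀ x j → S x j ≈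
      1# + (H a (j ∸ D x a) + (H b (j ∸ D x b) + (H c (j ∸ D x c) + H d (j ∸ D x d)))))
    (H-zero : ∀ y → H y 0 ≈ 0#)
    (H-suc : ∀ y j → H y (suc j) ≈ H y j + q ^ suc j * (ω y * S y (suc j))) where

    -- V 0 is set to 0, the value the recurrences require, although the empty list may follow a part 0_c.
    F V : ℕ → Carrier
    F = S b
    V zero = 0#
    V (suc j) = S c (suc j)

    S-a : ∀ j → S a (suc j) ≈ F j
    S-a j = trans (S-equation a (suc j)) (sym (S-equation b j))

    S-d : ∀ j → S d j ≈ S c j
    S-d j = trans (S-equation d j) (sym (S-equation c j))

    H-a : ∀ j → H a (suc j) ≈ H a j + q ^ suc j * (ω a * F j)
    H-a j = trans (H-suc a j) (+-congˡ (*-congˡ (*-congˡ (S-a j))))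

    H-b : ∀ j → H b (suc j) ≈ H b j + q ^ suc j * F (suc j)
    H-b j = trans (H-suc b j) (+-congˡ (*-congˡ (trans (*-congʳ ω-b) (*-identityˡ _))))

    -- Written with `j ∸ 1` to include index 0, where both values of `H d` coincide and `V 0` is 0.
    -- `V-step` needs this because the entries of `D` in column d are 1 in row b and 2 in row c.
    H-d : ∀ j → H d j ≈ H d (j ∸ 1) + q ^ j * (ω d * V j)
    H-d zero = sym (trans (+-congˡ (trans (*-identityˡ _) (zeroʳ _))) (+-identityʳ _))
    H-d (suc j) = trans (H-suc d j) (+-congˡ (*-congˡ (*-congˡ (S-d (suc j)))))

    F₀ : F 0 ≈ 1#
    F₀ = begin
      F 0                                          ≈⟨ S-equation b 0 ⟩
      1# + (H a 0 + (H b 0 + (H c 0 + H d 0)))     ≈⟨ +-congˡ (+-cong (H-zero a) (+-cong (H-zero b) (+-cong (H-zero c) (H-zero d)))) ⟩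
      1# + (0# + (0# + (0# + 0#)))                 ≈⟨ solve 0 (con (ℤ.+ 1) :+ (con (ℤ.+ 0) :+ (con (ℤ.+ 0) :+ (con (ℤ.+ 0) :+ con (ℤ.+ 0)))) := con (ℤ.+ 1)) refl ⟩
      1# ∎

    F₁ : F 1 ≈ q ^ 1 * F 1 + F 0
    F₁ = begin
      F 1                                                               ≈⟨ S-equation b 1 ⟩
      1# + (H a 0 + (H b 1 + (H c 0 + H d 0)))                          ≈⟨ +-congˡ (+-congˡ (+-congʳ (H-b 0))) ⟩
      1# + (H a 0 + (H b 0 + q ^ 1 * F 1 + (H c 0 + H d 0)))
        ≈⟨ solve 5 (λ i j k l m → con (ℤ.+ 1) :+ (i :+ (j :+ m :+ (k :+ l))) := m :+ (con (ℤ.+ 1) :+ (i :+ (j :+ (k :+ l)))))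
             refl (H a 0) (H b 0) (H c 0) (H d 0) (q ^ 1 * F 1) ⟩
      q ^ 1 * F 1 + (1# + (H a 0 + (H b 0 + (H c 0 + H d 0))))          ≈⟨ +-congˡ (S-equation b 0) ⟨
      q ^ 1 * F 1 + F 0 ∎

    -- Between the expansions of F at n + 1 and n + 2 each of the four arguments of `H` grows by
    -- one, so each colour contributes one new leading part.
    F-step : ∀ n → F (suc (suc n)) ≈ q ^ suc (suc n) * F (suc (suc n)) + F (suc n)
      + (ω c + ω d) * (q ^ suc n * V (suc n)) + ω a * q * (q ^ n * F n)
    F-step n = begin
      F (suc (suc n))
        ≈⟨ S-equation b (suc (suc n)) ⟩
      1# + (H a (suc n) + (H b (suc (suc n)) + (H c (suc n) + H d (suc n))))
        ≈⟨ +-congˡ (+-cong (H-a n) (+-cong (H-b (suc n)) (+-cong (H-suc c n) (H-d (suc n))))) ⟩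
      1# + (H a n + q * q ^ n * (ω a * F n) + (H b (suc n) + y * F (suc (suc n))
        + (H c n + x * (ω c * V (suc n)) + (H d n + x * (ω d * V (suc n))))))
        ≈⟨ solve 14 (λ i j k l q p x y wa wc wd f f₂ v →
             con (ℤ.+ 1) :+ (i :+ q :* p :* (wa :* f) :+ (j :+ y :* f₂ :+ (k :+ x :* (wc :* v) :+ (l :+ x :* (wd :* v)))))
             := y :* f₂ :+ (con (ℤ.+ 1) :+ (i :+ (j :+ (k :+ l)))) :+ (wc :+ wd) :* (x :* v) :+ wa :* q :* (p :* f)) refl
             (H a n) (H b (suc n)) (H c n) (H d n) q (q ^ n) x y (ω a) (ω c) (ω d)
             (F n) (F (suc (suc n))) (V (suc n)) ⟩
      y * F (suc (suc n)) + (1# + (H a n + (H b (suc n) + (H c n + H d n))))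
        + (ω c + ω d) * (x * V (suc n)) + ω a * q * (q ^ n * F n)
        ≈⟨ +-congʳ (+-congʳ (+-congˡ (S-equation b (suc n)))) ⟨
      y * F (suc (suc n)) + F (suc n) + (ω c + ω d) * (x * V (suc n)) + ω a * q * (q ^ n * F n) ∎
      where
      x y : Carrier
      x = q ^ suc n
      y = q ^ suc (suc n)

    -- Rows b and c are compared at the same value n + 1. In row c the arguments for colours a and c
    -- are one larger and that for b one smaller; for d it is one smaller, up to truncation at 0.
    -- The corrections are placed so that no subtraction occurs.
    V-step : ∀ n → V (suc n) + q ^ suc n * F (suc n) + ω d * (q ^ n * V n) ≈
      F (suc n) + ω a * q * (q ^ n * F n) + ω c * (q ^ suc n * V (suc n))
    V-step n = begin
      V (suc n) + x * F (suc n) + ω d * (q ^ n * V n)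
        ≈⟨ +-congʳ (+-congʳ (trans (S-equation c (suc n)) (+-congˡ (+-cong (H-a n) (+-congˡ (+-congʳ (H-suc c n))))))) ⟩
      1# + (H a n + q * q ^ n * (ω a * F n) + (H b n + (H c n + x * (ω c * V (suc n)) + H d (n ∸ 1))))
        + x * F (suc n) + ω d * (q ^ n * V n)
        ≈⟨ solve 14 (λ i j k l q p x wa wc wd f f₁ v v₁ →
             con (ℤ.+ 1) :+ (i :+ q :* p :* (wa :* f) :+ (j :+ (k :+ x :* (wc :* v₁) :+ l))) :+ x :* f₁ :+ wd :* (p :* v)
             := con (ℤ.+ 1) :+ (i :+ (j :+ x :* f₁ :+ (k :+ (l :+ p :* (wd :* v))))) :+ wa :* q :* (p :* f) :+ wc :* (x :* v₁))
             refl (H a n) (H b n) (H c n) (H d (n ∸ 1)) q (q ^ n) x (ω a) (ω c) (ω d)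
             (F n) (F (suc n)) (V n) (V (suc n)) ⟩
      1# + (H a n + (H b n + x * F (suc n) + (H c n + (H d (n ∸ 1) + q ^ n * (ω d * V n)))))
        + ω a * q * (q ^ n * F n) + ω c * (x * V (suc n))
        ≈⟨ +-congʳ (+-congʳ (+-congˡ (+-congˡ (+-cong (H-b n) (+-congˡ (H-d n)))))) ⟨
      1# + (H a n + (H b (suc n) + (H c n + H d n))) + ω a * q * (q ^ n * F n) + ω c * (x * V (suc n))
        ≈⟨ +-congʳ (+-congʳ (S-equation b (suc n))) ⟨
      F (suc n) + ω a * q * (q ^ n * F n) + ω c * (x * V (suc n)) ∎
      where
      x : Carrier
      x = q ^ suc n

-- Counting by explicit bijections with finite sets.

module Count where
  open import Data.Nat using (_+_; _*_; _≤ᵇ_; _≡ᵇ_)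
  open import Relation.Binary.PropositionalEquality using (refl; sym; trans; cong; cong₂; subst)
  open Decidable⇒UIP Bool._≟_ using (≡-irrelevant)

  -- Irrelevance reduces equality in `⟦ P ⟧` to equality of lists, so inverse laws never compare
  -- proofs.
  record Property : Set₁ where
    field
      holds : List Part → Set
      irrelevant : ∀ {p} (x y : holds p) → x ≡ y
  open Property

  ⟦_⟧ : Property → Set
  ⟦ P ⟧ = Σ (List Part) (holds P)

  ⟦⟧-≡ : ∀ P {p p′} {x : holds P p} {x′ : holds P p′} → p ≡ p′ → (p , x) ≡ (p′ , x′)
  ⟦⟧-≡ P refl = cong (_ ,_) (irrelevant P _ _)

  Card : Property → ℕ → Set
  Card P A = Fin A ↔ ⟦ P ⟧

  ⟦⟧-cong : ∀ P Q → (∀ {p} → holds P p → holds Q p) → (∀ {p} → holds Q p → holds P p) → ⟦ P ⟧ ↔ ⟦ Q ⟧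
  ⟦⟧-cong P Q f g = mk↔ₛ′ (λ (p , x) → p , f x) (λ (p , x) → p , g x) (λ _ → ⟦⟧-≡ Q refl) (λ _ → ⟦⟧-≡ P refl)

  ⟦⟧-∅ : ∀ P → (∀ {p} → ¬ holds P p) → Card P 0
  ⟦⟧-∅ P f = ↔-trans 0↔⊥ (mk↔ₛ′ (λ ()) (λ (_ , x) → f x) (λ (_ , x) → ⊥-elim (f x)) (λ ()))

  ⟦⟧-⊎ : ∀ P Q R → (∀ {p} → holds P p → holds Q p ⊎ holds R p) →
         (∀ {p} → holds Q p → holds P p) → (∀ {p} → holds R p → holds P p) →
         (∀ {p} → holds Q p → ¬ holds R p) → (⟦ Q ⟧ ⊎ ⟦ R ⟧) ↔ ⟦ P ⟧
  ⟦⟧-⊎ P Q R split l r disjoint = mk↔ₛ′ to from (λ _ → to∘from _) from∘to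
    where
    to : ⟦ Q ⟧ ⊎ ⟦ R ⟧ → ⟦ P ⟧
    to (inj₁ (p , x)) = p , l x
    to (inj₂ (p , x)) = p , r x
    from : ⟦ P ⟧ → ⟦ Q ⟧ ⊎ ⟦ R ⟧
    from (p , x) with split x
    ... | inj₁ y = inj₁ (p , y)
    ... | inj₂ y = inj₂ (p , y)
    to∘from : ∀ s → to (from s) ≡ s
    to∘from (p , x) with split x
    ... | inj₁ y = ⟦⟧-≡ P refl
    ... | inj₂ y = ⟦⟧-≡ P refl
    from∘to : ∀ s → from (to s) ≡ s
    from∘to (inj₁ (p , x)) with split (l x)
    ... | inj₁ y = cong inj₁ (⟦⟧-≡ Q refl)
    ... | inj₂ y = ⊥-elim (disjoint x y)
    from∘to (inj₂ (p , x)) with split (r x)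
    ... | inj₁ y = ⊥-elim (disjoint y x)
    ... | inj₂ y = cong inj₂ (⟦⟧-≡ R refl)

  -- The value is f (n - e) if e ≤ n and 0 otherwise: on coefficients, multiplication by the e-th
  -- power of a variable.
  shiftBy : ℕ → (ℕ → ℕ) → ℕ → ℕ
  shiftBy zero f n = f n
  shiftBy (suc e) f zero = 0
  shiftBy (suc e) f (suc n) = shiftBy e f n

  -- The cardinality is asked for only where n′ + e ≡ n. For the size this equation shows that n′ is
  -- smaller than n when e is positive, so an induction hypothesis on smaller sizes suffices.
  shift-card : (G : ℕ → ℕ → Property) →
    (∀ e {p} → ¬ holds (G (suc e) 0) p) →
    (∀ e n {p} → holds (G e n) p → holds (G (suc e) (suc n)) p) →
    (∀ e n {p} → holds (G (suc e) (suc n)) p → holds (G e n) p) →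
    ∀ {f} e n → (∀ n′ → n′ + e ≡ n → Card (G 0 n′) (f n′)) → Card (G e n) (shiftBy e f n)
  shift-card G empty up down zero n card = card n (ℕ.+-identityʳ n)
  shift-card G empty up down (suc e) zero card = ⟦⟧-∅ (G (suc e) 0) (empty e)
  shift-card G empty up down (suc e) (suc n) card = ↔-trans
    (shift-card G empty up down e n (λ n′ eq → card n′ (trans (ℕ.+-suc n′ e) (cong suc eq))))
    (⟦⟧-cong (G e n) (G (suc e) (suc n)) (up e n) (down e n))

  follows : Part → List Part → Bool
  follows π [] = true
  follows π (p ∷ ps) = consecutiveOK π p ∧ valid (p ∷ ps)

  valid-∷ : ∀ p ps → valid (p ∷ ps) ≡ positive p ∧ follows p ps
  valid-∷ p [] = sym (Bool.∧-identityʳ _)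
  valid-∷ p (p′ ∷ ps) = refl

  weight : Colour → Colour → ℕ
  weight z y with isColour z y
  ... | true = 1
  ... | false = 0

  count-∷ : ∀ z k y ps → count z ((k , y) ∷ ps) ≡ weight z y + count z ps
  count-∷ z k y ps with isColour z y
  ... | true = refl
  ... | false = refl

  -- The offsets e₁ … e₄ raise the statistics of the list, so that a leading part is split off one unit at a time.
  follower : (e₁ e₂ e₃ e₄ : ℕ) → Part → (n k ℓ m : ℕ) → Property
  follower e₁ e₂ e₃ e₄ π n k ℓ m = record
    { holds = λ p → (follows π p ≡ true) × (e₁ + size p ≡ n) × (e₂ + count a p ≡ k)
                    × (e₃ + count c p ≡ ℓ) × (e₄ + count d p ≡ m)
    ; irrelevant = λ (x , x₁ , x₂ , x₃ , x₄) (y , y₁ , y₂ , y₃ , y₄) →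
        cong₂ _,_ (≡-irrelevant x y) (cong₂ _,_ (ℕ.≡-irrelevant x₁ y₁) (cong₂ _,_ (ℕ.≡-irrelevant x₂ y₂)
          (cong₂ _,_ (ℕ.≡-irrelevant x₃ y₃) (ℕ.≡-irrelevant x₄ y₄))))
    }

  tails : Part → (n k ℓ m : ℕ) → Property
  tails = follower 0 0 0 0

  Count : Set
  Count = ℕ → ℕ → ℕ → ℕ → ℕ

  shiftByPart : Part → Count → Count
  shiftByPart (e , y) W n k ℓ m =
    shiftBy e (λ n → shiftBy (weight a y) (λ k → shiftBy (weight c y) (λ ℓ →
      shiftBy (weight d y) (W n k ℓ) m) ℓ) k) n

  followerOf : Part → (n k ℓ m : ℕ) → Property
  followerOf (e , y) = follower e (weight a y) (weight c y) (weight d y) (e , y)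

  followerOf-card : ∀ π {n W} → (∀ n′ → n′ + proj₁ π ≡ n → ∀ k ℓ m → Card (tails π n′ k ℓ m) (W n′ k ℓ m)) →
                    ∀ k ℓ m → Card (followerOf π n k ℓ m) (shiftByPart π W n k ℓ m)
  followerOf-card π@(e , y) {n} {W} card k ℓ m =
    shift-card (λ e₁ n → follower e₁ e₂ e₃ e₄ π n k ℓ m) (λ { _ (_ , () , _) })
      (λ _ _ (x , x₁ , xs) → x , cong suc x₁ , xs) (λ _ _ (x , x₁ , xs) → x , ℕ.suc-injective x₁ , xs) e n
    λ n′ eq →
    shift-card (λ e₂ k → follower 0 e₂ e₃ e₄ π n′ k ℓ m) (λ { _ (_ , _ , () , _) })
      (λ _ _ (x , x₁ , x₂ , xs) → x , x₁ , cong suc x₂ , xs)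
      (λ _ _ (x , x₁ , x₂ , xs) → x , x₁ , ℕ.suc-injective x₂ , xs) e₂ k
    λ k′ _ →
    shift-card (λ e₃ ℓ → follower 0 0 e₃ e₄ π n′ k′ ℓ m) (λ { _ (_ , _ , _ , () , _) })
      (λ _ _ (x , x₁ , x₂ , x₃ , xs) → x , x₁ , x₂ , cong suc x₃ , xs)
      (λ _ _ (x , x₁ , x₂ , x₃ , xs) → x , x₁ , x₂ , ℕ.suc-injective x₃ , xs) e₃ ℓ
    λ ℓ′ _ →
    shift-card (λ e₄ m → follower 0 0 0 e₄ π n′ k′ ℓ′ m) (λ { _ (_ , _ , _ , _ , ()) })
      (λ _ _ (x , x₁ , x₂ , x₃ , x₄) → x , x₁ , x₂ , x₃ , cong suc x₄)
      (λ _ _ (x , x₁ , x₂ , x₃ , x₄) → x , x₁ , x₂ , x₃ , ℕ.suc-injective x₄) e₄ m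
    λ m′ _ → card n′ eq k′ ℓ′ m′
    where
    e₂ e₃ e₄ : ℕ
    e₂ = weight a y
    e₃ = weight c y
    e₄ = weight d y

  isColour-refl : ∀ y → isColour y y ≡ true
  isColour-refl a = refl
  isColour-refl b = refl
  isColour-refl c = refl
  isColour-refl d = refl

  -- The statistics are those of the whole list; the share of the head enters as the offsets of
  -- `followerOf (j , y)`.
  headed : Colour → ℕ → (n k ℓ m : ℕ) → Property
  headed y K n k ℓ m = record { holds = h ; irrelevant = λ {p} → irr p }
    where
    h : List Part → Set
    h [] = ⊥
    h ((j , z) ∷ ps) = (isColour y z ≡ true) × (1 ≤ j) × (j ≤ K) × holds (followerOf (j , y) n k ℓ m) ps
    irr : ∀ p (x x′ : h p) → x ≡ x′
    irr ((j , z) ∷ ps) (x , x₁ , x₂ , xs) (y₀ , y₁ , y₂ , ys) =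
      cong₂ _,_ (≡-irrelevant x y₀) (cong₂ _,_ (ℕ.≤-irrelevant x₁ y₁) (cong₂ _,_ (ℕ.≤-irrelevant x₂ y₂)
        (irrelevant (followerOf (j , y) n k ℓ m) {ps} xs ys)))

  starting : Part → (n k ℓ m : ℕ) → Property
  starting (i , y) n k ℓ m = record { holds = h ; irrelevant = λ {p} → irr p }
    where
    h : List Part → Set
    h [] = ⊥
    h ((j , z) ∷ ps) = (isColour y z ≡ true) × (j ≡ i) × holds (followerOf (i , y) n k ℓ m) ps
    irr : ∀ p (x x′ : h p) → x ≡ x′
    irr ((j , z) ∷ ps) (x , x₁ , xs) (y₀ , y₁ , ys) =
      cong₂ _,_ (≡-irrelevant x y₀) (cong₂ _,_ (ℕ.≡-irrelevant x₁ y₁)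
        (irrelevant (followerOf (i , y) n k ℓ m) {ps} xs ys))

  isColour-sound : ∀ y z → isColour y z ≡ true → y ≡ z
  isColour-sound a a _ = refl
  isColour-sound b b _ = refl
  isColour-sound c c _ = refl
  isColour-sound d d _ = refl

  followerOf↔starting : ∀ π n k ℓ m → ⟦ followerOf π n k ℓ m ⟧ ↔ ⟦ starting π n k ℓ m ⟧
  followerOf↔starting π@(i , y) n k ℓ m = mk↔ₛ′ to from to∘from (λ _ → ⟦⟧-≡ (followerOf π n k ℓ m) refl)
    where
    to : ⟦ followerOf π n k ℓ m ⟧ → ⟦ starting π n k ℓ m ⟧
    to (ps , xs) = (π ∷ ps) , isColour-refl y , refl , xs
    from : ⟦ starting π n k ℓ m ⟧ → ⟦ followerOf π n k ℓ m ⟧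
    from (_ ∷ ps , _ , _ , xs) = ps , xs
    to∘from : ∀ s → to (from s) ≡ s
    to∘from ((j , z) ∷ ps , x , x₁ , xs) = ⟦⟧-≡ (starting π n k ℓ m)
      (cong (_∷ ps) (cong₂ _,_ (sym x₁) (isColour-sound y z x)))

  headedCount : (Part → Count) → Colour → ℕ → Count
  headedCount W y zero n k ℓ m = 0
  headedCount W y (suc K) n k ℓ m = headedCount W y K n k ℓ m + shiftByPart (suc K , y) (W (suc K , y)) n k ℓ m

  -- The induction is on size: removing a positive head lowers it, whereas nothing else decreases
  -- uniformly over the preceding part π.
  CardBelow : (Part → Count) → ℕ → Set
  CardBelow W n = ∀ n′ → n′ < n → ∀ π k ℓ m → Card (tails π n′ k ℓ m) (W π n′ k ℓ m)

  headed-card : ∀ {W n} → CardBelow W n → ∀ y K k ℓ m → Card (headed y K n k ℓ m) (headedCount W y K n k ℓ m)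
  headed-card {n = n} card y zero k ℓ m = ⟦⟧-∅ (headed y 0 n k ℓ m) λ { {_ ∷ _} (_ , s≤s _ , () , _) }
  headed-card {W} {n} card y (suc K) k ℓ m = ↔-trans +↔⊎ (↔-trans
    (headed-card card y K k ℓ m ⊎-↔ ↔-trans
      (followerOf-card (suc K , y) (λ n′ eq → card n′ (ℕ.≤-trans (s≤s (ℕ.m≤m+n n′ K))
        (ℕ.≤-reflexive (trans (sym (ℕ.+-suc n′ K)) eq))) (suc K , y)) k ℓ m)
      (followerOf↔starting (suc K , y) n k ℓ m))
    (⟦⟧-⊎ (headed y (suc K) n k ℓ m) (headed y K n k ℓ m) (starting (suc K , y) n k ℓ m)
      (λ {p} → split {p}) (λ {p} → l {p}) (λ {p} → r {p}) (λ {p} → disjoint {p})))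
    where
    split : ∀ {p} → holds (headed y (suc K) n k ℓ m) p →
            holds (headed y K n k ℓ m) p ⊎ holds (starting (suc K , y) n k ℓ m) p
    split {(j , z) ∷ ps} (x , x₁ , x₂ , xs) with ℕ.m≤n⇒m<n∨m≡n x₂
    ... | inj₁ (s≤s j≤K) = inj₁ (x , x₁ , j≤K , xs)
    ... | inj₂ refl = inj₂ (x , refl , xs)
    l : ∀ {p} → holds (headed y K n k ℓ m) p → holds (headed y (suc K) n k ℓ m) p
    l {_ ∷ _} (x , x₁ , x₂ , xs) = x , x₁ , ℕ.m≤n⇒m≤1+n x₂ , xs
    r : ∀ {p} → holds (starting (suc K , y) n k ℓ m) p → holds (headed y (suc K) n k ℓ m) p
    r {_ ∷ _} (x , refl , xs) = x , s≤s z≤n , ℕ.≤-refl , xs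
    disjoint : ∀ {p} → holds (headed y K n k ℓ m) p → ¬ holds (starting (suc K , y) n k ℓ m) p
    disjoint {_ ∷ _} (_ , _ , x₂ , _) (_ , refl , _) = ℕ.<-irrefl refl x₂

  ≤ᵇ-sound : ∀ {m n} → (m ≤ᵇ n) ≡ true → m ≤ n
  ≤ᵇ-sound {m} {n} eq = ℕ.≤ᵇ⇒≤ m n (subst T (sym eq) tt)

  ≤ᵇ-complete : ∀ {m n} → m ≤ n → (m ≤ᵇ n) ≡ true
  ≤ᵇ-complete {m} {n} m≤n with m ≤ᵇ n | ℕ.≤⇒≤ᵇ m≤n
  ... | true | _ = refl

  -- The order on coloured parts is implied by the difference conditions.
  rank-bound : ∀ x y → rank y ≤ 4 * D x y + rank x
  rank-bound a a = ≤ᵇ-sound refl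
  rank-bound a b = ≤ᵇ-sound refl
  rank-bound a c = ≤ᵇ-sound refl
  rank-bound a d = ≤ᵇ-sound refl
  rank-bound b a = ≤ᵇ-sound refl
  rank-bound b b = ≤ᵇ-sound refl
  rank-bound b c = ≤ᵇ-sound refl
  rank-bound b d = ≤ᵇ-sound refl
  rank-bound c a = ≤ᵇ-sound refl
  rank-bound c b = ≤ᵇ-sound refl
  rank-bound c c = ≤ᵇ-sound refl
  rank-bound c d = ≤ᵇ-sound refl
  rank-bound d a = ≤ᵇ-sound refl
  rank-bound d b = ≤ᵇ-sound refl
  rank-bound d c = ≤ᵇ-sound refl
  rank-bound d d = ≤ᵇ-sound refl

  consecutiveOK-intro : ∀ {j x i y} → i + D x y ≤ j → consecutiveOK (j , x) (i , y) ≡ true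
  consecutiveOK-intro {j} {x} {i} {y} i+D≤j = cong₂ _∧_ (≤ᵇ-complete keys) (≤ᵇ-complete i+D≤j)
    where
    open ℕ.≤-Reasoning
    keys : 4 * i + rank y ≤ 4 * j + rank x
    keys = begin
      4 * i + rank y                 ≤⟨ ℕ.+-monoʳ-≤ (4 * i) (rank-bound x y) ⟩
      4 * i + (4 * D x y + rank x)   ≡⟨ ℕ.+-assoc (4 * i) _ _ ⟨
      4 * i + 4 * D x y + rank x     ≡⟨ cong (_+ rank x) (ℕ.*-distribˡ-+ 4 i (D x y)) ⟨
      4 * (i + D x y) + rank x       ≤⟨ ℕ.+-monoˡ-≤ (rank x) (ℕ.*-monoʳ-≤ 4 i+D≤j) ⟩
      4 * j + rank x                 ∎

  -- If j < D, the truncated difference is 0 and excludes every positive i; this makes the bound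
  -- `j ∸ D x y` on heads exact.
  positive-≤∸ : ∀ {i j} D → 1 ≤ i → i ≤ j ∸ D → i + D ≤ j
  positive-≤∸ {i} {j} D 1≤i i≤j∸D with ℕ.≤-<-connex D j
  ... | inj₁ D≤j = ℕ.m≤o∸n⇒m+n≤o i D≤j i≤j∸D
  ... | inj₂ j<D with ℕ.≤-trans 1≤i (ℕ.≤-trans i≤j∸D (ℕ.≤-reflexive (ℕ.m≤n⇒m∸n≡0 (ℕ.<⇒≤ j<D))))
  ... | ()

  module _ (j : ℕ) (x : Colour) (n k ℓ m : ℕ) where
    private
      H : Colour → Property
      H y = headed y (j ∸ D x y) n k ℓ m

    tails⇒headed : ∀ i y ps → holds (tails (j , x) n k ℓ m) ((i , y) ∷ ps) → holds (H y) ((i , y) ∷ ps)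
    tails⇒headed i y ps (f , s , ca , cc , cd) =
      isColour-refl y ,
      ≤ᵇ-sound (Bool.∧-conicalˡ _ _ parts) ,
      ℕ.m+n≤o⇒m≤o∸n i (≤ᵇ-sound (Bool.∧-conicalʳ _ _ (Bool.∧-conicalˡ (consecutiveOK (j , x) (i , y)) _ f))) ,
      Bool.∧-conicalʳ (positive (i , y)) _ parts ,
      s , trans (sym (count-∷ a i y ps)) ca , trans (sym (count-∷ c i y ps)) cc , trans (sym (count-∷ d i y ps)) cd
      where
      parts : positive (i , y) ∧ follows (i , y) ps ≡ true
      parts = trans (sym (valid-∷ (i , y) ps)) (Bool.∧-conicalʳ (consecutiveOK (j , x) (i , y)) _ f)

    headed⇒tails : ∀ i y ps → holds (H y) ((i , y) ∷ ps) → holds (tails (j , x) n k ℓ m) ((i , y) ∷ ps)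
    headed⇒tails i y ps (_ , 1≤i , i≤ , f , s , ca , cc , cd) =
      cong₂ _∧_ (consecutiveOK-intro {j} {x} (positive-≤∸ (D x y) 1≤i i≤))
        (trans (valid-∷ (i , y) ps) (cong₂ _∧_ (≤ᵇ-complete 1≤i) f)) ,
      s , trans (count-∷ a i y ps) ca , trans (count-∷ c i y ps) cc , trans (count-∷ d i y ps) cd

    empty : Property
    empty = record { holds = h ; irrelevant = λ {p} → irr p }
      where
      h : List Part → Set
      h [] = holds (tails (j , x) n k ℓ m) []
      h (_ ∷ _) = ⊥
      irr : ∀ p (x x′ : h p) → x ≡ x′
      irr [] = irrelevant (tails (j , x) n k ℓ m) {[]}

    tails-split : (⟦ empty ⟧ ⊎ (⟦ H a ⟧ ⊎ (⟦ H b ⟧ ⊎ (⟦ H c ⟧ ⊎ ⟦ H d ⟧)))) ↔ ⟦ tails (j , x) n k ℓ m ⟧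
    tails-split = mk↔ₛ′ to from to∘from from∘to
      where
      unhead : ∀ y → ⟦ H y ⟧ → ⟦ tails (j , x) n k ℓ m ⟧
      unhead y ((i , z) ∷ ps , xs@(y≡z , _)) with isColour-sound y z y≡z
      ... | refl = (i , y) ∷ ps , headed⇒tails i y ps xs
      to : ⟦ empty ⟧ ⊎ (⟦ H a ⟧ ⊎ (⟦ H b ⟧ ⊎ (⟦ H c ⟧ ⊎ ⟦ H d ⟧))) → ⟦ tails (j , x) n k ℓ m ⟧
      to (inj₁ ([] , xs)) = [] , xs
      to (inj₂ (inj₁ s)) = unhead a s
      to (inj₂ (inj₂ (inj₁ s))) = unhead b s
      to (inj₂ (inj₂ (inj₂ (inj₁ s)))) = unhead c s
      to (inj₂ (inj₂ (inj₂ (inj₂ s)))) = unhead d s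
      inject : ∀ y → ⟦ H y ⟧ → ⟦ empty ⟧ ⊎ (⟦ H a ⟧ ⊎ (⟦ H b ⟧ ⊎ (⟦ H c ⟧ ⊎ ⟦ H d ⟧)))
      inject a s = inj₂ (inj₁ s)
      inject b s = inj₂ (inj₂ (inj₁ s))
      inject c s = inj₂ (inj₂ (inj₂ (inj₁ s)))
      inject d s = inj₂ (inj₂ (inj₂ (inj₂ s)))
      from : ⟦ tails (j , x) n k ℓ m ⟧ → ⟦ empty ⟧ ⊎ (⟦ H a ⟧ ⊎ (⟦ H b ⟧ ⊎ (⟦ H c ⟧ ⊎ ⟦ H d ⟧)))
      from ([] , xs) = inj₁ ([] , xs)
      from ((i , y) ∷ ps , xs) = inject y ((i , y) ∷ ps , tails⇒headed i y ps xs)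
      to-inject : ∀ y s → to (inject y s) ≡ unhead y s
      to-inject a s = refl
      to-inject b s = refl
      to-inject c s = refl
      to-inject d s = refl
      unhead-list : ∀ y s → proj₁ (unhead y s) ≡ proj₁ s
      unhead-list y ((i , z) ∷ ps , xs@(y≡z , _)) with isColour-sound y z y≡z
      ... | refl = refl
      to∘from : ∀ s → to (from s) ≡ s
      to∘from ([] , xs) = refl
      to∘from ((i , y) ∷ ps , xs) = trans (to-inject y s) (⟦⟧-≡ (tails (j , x) n k ℓ m) (unhead-list y s))
        where
        s : ⟦ H y ⟧
        s = (i , y) ∷ ps , tails⇒headed i y ps xs
      from-unhead : ∀ y s → from (unhead y s) ≡ inject y s
      from-unhead y ((i , z) ∷ ps , xs@(y≡z , _)) with isColour-sound y z y≡z
      ... | refl = cong (inject y) (⟦⟧-≡ (H y) refl)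
      from∘to : ∀ s → from (to s) ≡ s
      from∘to (inj₁ ([] , xs)) = refl
      from∘to (inj₂ (inj₁ s)) = from-unhead a s
      from∘to (inj₂ (inj₂ (inj₁ s))) = from-unhead b s
      from∘to (inj₂ (inj₂ (inj₂ (inj₁ s)))) = from-unhead c s
      from∘to (inj₂ (inj₂ (inj₂ (inj₂ s)))) = from-unhead d s

  nilCount : Count
  nilCount 0 0 0 0 = 1
  nilCount _ _ _ _ = 0

  nil-card : ∀ j x n k ℓ m → Card (empty j x n k ℓ m) (nilCount n k ℓ m)
  nil-card j x 0 0 0 0 = ↔-trans 1↔⊤ (mk↔ₛ′ (λ _ → [] , refl , refl , refl , refl , refl) (λ _ → tt)
    (λ { ([] , _) → ⟦⟧-≡ (empty j x 0 0 0 0) refl }) (λ _ → refl))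
  nil-card j x (suc n) k ℓ m = ⟦⟧-∅ (empty j x (suc n) k ℓ m) λ { {[]} (_ , () , _) }
  nil-card j x 0 (suc k) ℓ m = ⟦⟧-∅ (empty j x 0 (suc k) ℓ m) λ { {[]} (_ , _ , () , _) }
  nil-card j x 0 0 (suc ℓ) m = ⟦⟧-∅ (empty j x 0 0 (suc ℓ) m) λ { {[]} (_ , _ , _ , () , _) }
  nil-card j x 0 0 0 (suc m) = ⟦⟧-∅ (empty j x 0 0 0 (suc m)) λ { {[]} (_ , _ , _ , _ , ()) }

  tailCount : (Part → Count) → Part → Count
  tailCount W (j , x) n k ℓ m = nilCount n k ℓ m + (h a + (h b + (h c + h d)))
    where
    h : Colour → ℕ
    h y = headedCount W y (j ∸ D x y) n k ℓ m

  tails-card : ∀ {W n} → CardBelow W n → ∀ π k ℓ m → Card (tails π n k ℓ m) (tailCount W π n k ℓ m)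
  tails-card {n = n} card (j , x) k ℓ m = ↔-trans (sum (nil-card j x n k ℓ m)
    (sum (h a) (sum (h b) (sum (h c) (h d))))) (tails-split j x n k ℓ m)
    where
    h : ∀ y → Card (headed y (j ∸ D x y) n k ℓ m) _
    h y = headed-card card y (j ∸ D x y) k ℓ m
    sum : ∀ {A B} {S T : Set} → Fin A ↔ S → Fin B ↔ T → Fin (A + B) ↔ (S ⊎ T)
    sum p r = ↔-trans +↔⊎ (p ⊎-↔ r)

  -- The counts recurse through the size, not through a structural argument; f iterations give the
  -- right numbers for all sizes below f.
  iterate : ℕ → Part → Count
  iterate zero π n k ℓ m = 0
  iterate (suc f) = tailCount (iterate f)

  iterate-card : ∀ f → CardBelow (iterate f) f
  iterate-card (suc f) n (s≤s n≤f) π k ℓ m =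
    tails-card (λ n′ n′<n → iterate-card f n′ (ℕ.≤-trans n′<n n≤f)) π k ℓ m

  abstract
    -- Kept abstract because only the bijection below characterises it from here on.
    tailNumber : Part → Count
    tailNumber π n = iterate (suc n) π n

    tailNumber-card : ∀ π n k ℓ m → Card (tails π n k ℓ m) (tailNumber π n k ℓ m)
    tailNumber-card π n = iterate-card (suc n) n ℕ.≤-refl π

  -- Both sides count the same finite set, so they are equal; no comparison between different
  -- numbers of iterations has to be made.
  tailNumber-equation : ∀ π n k ℓ m → tailNumber π n k ℓ m ≡ tailCount tailNumber π n k ℓ m
  tailNumber-equation π n k ℓ m = ↔⇒≡ (↔-trans (tailNumber-card π n k ℓ m)
    (↔-sym (tails-card (λ n′ _ π k ℓ m → tailNumber-card π n′ k ℓ m) π k ℓ m)))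

  ≡ᵇ-sound : ∀ {m n} → (m ≡ᵇ n) ≡ true → m ≡ n
  ≡ᵇ-sound {m} {n} eq = ℕ.≡ᵇ⇒≡ m n (subst T (sym eq) tt)

  ≡ᵇ-complete : ∀ {m n} → m ≡ n → (m ≡ᵇ n) ≡ true
  ≡ᵇ-complete {m} {n} m≡n with m ≡ᵇ n | ℕ.≡⇒≡ᵇ m n m≡n
  ... | true | _ = refl

  D-b≤1 : ∀ y → D b y ≤ 1
  D-b≤1 a = s≤s z≤n
  D-b≤1 b = z≤n
  D-b≤1 c = s≤s z≤n
  D-b≤1 d = s≤s z≤n

  head-≤-size : ∀ i y ps {n} → size ((i , y) ∷ ps) ≡ n → i ≤ n
  head-≤-size i y ps eq = ℕ.≤-trans (ℕ.m≤m+n i (size ps)) (ℕ.≤-reflexive eq)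

  -- A fictitious part N of colour b is put in front. Parts of a partition of n are at most n < N
  -- and the entries of row b of `D` are at most 1, so it imposes no restriction.
  APartitions-card : ∀ {N n} k ℓ m → n < N → Fin (tailNumber (N , b) n k ℓ m) ↔ APartitions n k ℓ m
  APartitions-card {N} {n} k ℓ m n<N = ↔-trans (tailNumber-card (N , b) n k ℓ m)
    (⟦⟧-cong (tails (N , b) n k ℓ m) partitions (λ {p} → to {p}) (λ {p} → from {p}))
    where
    partitions : Property
    partitions = record { holds = λ p → isA n k ℓ m p ≡ true ; irrelevant = ≡-irrelevant }
    to : ∀ {p} → holds (tails (N , b) n k ℓ m) p → isA n k ℓ m p ≡ true
    to {p} (f , s , ca , cc , cd) = cong₂ _∧_ (valid-follower p f) (cong₂ _∧_ (≡ᵇ-complete s)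
      (cong₂ _∧_ (≡ᵇ-complete ca) (cong₂ _∧_ (≡ᵇ-complete cc) (≡ᵇ-complete cd))))
      where
      valid-follower : ∀ p → follows (N , b) p ≡ true → valid p ≡ true
      valid-follower [] _ = refl
      valid-follower (p ∷ ps) f = Bool.∧-conicalʳ (consecutiveOK (N , b) p) _ f
    from : ∀ {p} → isA n k ℓ m p ≡ true → holds (tails (N , b) n k ℓ m) p
    from {p} x = follower-valid p (Bool.∧-conicalˡ _ _ x) s , s ,
      ≡ᵇ-sound (Bool.∧-conicalˡ _ _ x₂) , ≡ᵇ-sound (Bool.∧-conicalˡ _ _ x₃) , ≡ᵇ-sound (Bool.∧-conicalʳ _ _ x₃)
      where
      x₁ : (size p ≡ᵇ n) ∧ (count a p ≡ᵇ k) ∧ (count c p ≡ᵇ ℓ) ∧ (count d p ≡ᵇ m) ≡ true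
      x₁ = Bool.∧-conicalʳ (valid p) _ x
      s : size p ≡ n
      s = ≡ᵇ-sound (Bool.∧-conicalˡ _ _ x₁)
      x₂ : (count a p ≡ᵇ k) ∧ (count c p ≡ᵇ ℓ) ∧ (count d p ≡ᵇ m) ≡ true
      x₂ = Bool.∧-conicalʳ (size p ≡ᵇ n) _ x₁
      x₃ : (count c p ≡ᵇ ℓ) ∧ (count d p ≡ᵇ m) ≡ true
      x₃ = Bool.∧-conicalʳ (count a p ≡ᵇ k) _ x₂
      follower-valid : ∀ p → valid p ≡ true → size p ≡ n → follows (N , b) p ≡ true
      follower-valid [] _ _ = refl
      follower-valid ((i , y) ∷ ps) v s = cong₂ _∧_ (consecutiveOK-intro {N} {b} {i} {y} (below y)) v
        where
        i≤n : i ≤ n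
        i≤n = head-≤-size i y ps s
        below : ∀ y → i + D b y ≤ N
        below y = ℕ.≤-trans (ℕ.+-mono-≤ i≤n (D-b≤1 y)) (ℕ.≤-trans (ℕ.≤-reflexive (ℕ.+-comm n 1)) n<N)

-- Translation of the given series operations into iterated power series rings.

-- ℤ[[d]], ℤ[[d]][[c]], ℤ[[d]][[c]][[a]] and ℤ[[d]][[c]][[a]][[q]].
R₀ R₁ R₂ R₃ R₄ : CommutativeRing _ _
R₀ = ℤ.+-*-commutativeRing
R₁ = PowerSeries.powerSeries R₀
R₂ = PowerSeries.powerSeries R₁
R₃ = PowerSeries.powerSeries R₂
R₄ = PowerSeries.powerSeries R₃

private
  module P₀ = PowerSeries R₀
  module P₁ = PowerSeries R₁
  module P₂ = PowerSeries R₂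
  module P₃ = PowerSeries R₃
  module P₄ = PowerSeries R₄
open CommutativeRing R₄ using (_≈_; _*_; 1#; refl; trans; sym; *-cong; *-congˡ; *-congʳ; -‿cong)
  renaming (_+_ to _⊞_; -_ to ⊟_; *-assoc to ⊠-assoc)
open Algebra.Properties.Semiring.Exp (CommutativeRing.semiring R₄) using (_^_)
module Lim = Limit R₃

sumTo≡sum : ∀ n h → sumTo n h ≡ P₀.sum n h
sumTo≡sum zero h = ≡.refl
sumTo≡sum (suc n) h = ≡.cong (λ s → s ℤ.+ h (suc n)) (sumTo≡sum n h)

sumTo-cong : ∀ n {f g} → (∀ i → f i ≡ g i) → sumTo n f ≡ sumTo n g
sumTo-cong zero p = p 0
sumTo-cong (suc n) p = ≡.cong₂ ℤ._+_ (sumTo-cong n p) (p (suc n))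

sum₁ : ∀ n h m → P₁.sum n h m ≡ sumTo n (λ i → h i m)
sum₁ n h m = ≡.trans (Evaluate.sum-coeff R₀ n h m) (≡.sym (sumTo≡sum n (λ i → h i m)))

sum₂ : ∀ n h ℓ m → P₂.sum n h ℓ m ≡ sumTo n (λ i → h i ℓ m)
sum₂ n h ℓ m = ≡.trans (Evaluate.sum-coeff R₁ n h ℓ m) (sum₁ n (λ i → h i ℓ) m)

sum₃ : ∀ n h k ℓ m → P₃.sum n h k ℓ m ≡ sumTo n (λ i → h i k ℓ m)
sum₃ n h k ℓ m = ≡.trans (Evaluate.sum-coeff R₂ n h k ℓ m) (sum₂ n (λ i → h i k) ℓ m)

sum₄ : ∀ j h n k ℓ m → P₄.sum j h n k ℓ m ≡ sumTo j (λ i → h i n k ℓ m)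
sum₄ j h n k ℓ m = ≡.trans (Evaluate.sum-coeff R₃ j h n k ℓ m) (sum₃ j (λ i → h i n) k ℓ m)

-- The four nested sums are the convolutions of the four layers of power series, opened one variable
-- at a time from q inwards.
⊛≈* : ∀ f g → f ⊛ g ≈ f * g
⊛≈* f g n k ℓ m = ≡.sym (≡.trans (P₃.·-sum f g n k ℓ m)
  (≡.trans (sum₃ n (λ i → f i P₂.· g (n ∸ i)) k ℓ m) (sumTo-cong n λ n₁ →
  ≡.trans (P₂.·-sum (f n₁) (g (n ∸ n₁)) k ℓ m)
  (≡.trans (sum₂ k (λ i → f n₁ i P₁.· g (n ∸ n₁) (k ∸ i)) ℓ m) (sumTo-cong k λ k₁ →
  ≡.trans (P₁.·-sum (f n₁ k₁) (g (n ∸ n₁) (k ∸ k₁)) ℓ m)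
  (≡.trans (sum₁ ℓ (λ i → f n₁ k₁ i P₀.· g (n ∸ n₁) (k ∸ k₁) (ℓ ∸ i)) m) (sumTo-cong ℓ λ ℓ₁ →
  ≡.trans (P₀.·-sum (f n₁ k₁ ℓ₁) (g (n ∸ n₁) (k ∸ k₁) (ℓ ∸ ℓ₁)) m)
    (≡.sym (sumTo≡sum m (λ i → f n₁ k₁ ℓ₁ i ℤ.* g (n ∸ n₁) (k ∸ k₁) (ℓ ∸ ℓ₁) (m ∸ i)))))))))))

α γ δ : CommutativeRing.Carrier R₃
α = P₂.X
γ = P₂.const P₁.X
δ = P₂.const (P₁.const P₀.X)

one≈1 : one ≈ 1#
one≈1 0 0 0 0 = ≡.refl
one≈1 0 0 0 (suc m) = ≡.refl
one≈1 0 0 (suc ℓ) m = ≡.refl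
one≈1 0 (suc k) ℓ m = ≡.refl
one≈1 (suc n) k ℓ m = ≡.refl

qpow≈X^ : ∀ e → qpow e ≈ P₃.X ^ e
qpow≈X^ zero = one≈1
qpow≈X^ (suc e) = trans delayed (*-congˡ {P₃.X} (qpow≈X^ e))
  where
  delayed : qpow (suc e) ≈ P₃.X * qpow e
  delayed zero k ℓ m = ≡.sym (P₃.X·-zero (qpow e) k ℓ m)
  delayed (suc n) k ℓ m = ≡.sym (P₃.X·-suc (qpow e) n k ℓ m)

𝕢≈X : 𝕢 ≈ P₃.X
𝕢≈X = trans (qpow≈X^ 1) (CommutativeRing.*-identityʳ R₄ P₃.X)

𝕒≈α : 𝕒 ≈ P₃.const α
𝕒≈α (suc n) k ℓ m = ≡.refl
𝕒≈α zero zero ℓ m = ≡.refl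
𝕒≈α zero (suc zero) zero zero = ≡.refl
𝕒≈α zero (suc zero) zero (suc m) = ≡.refl
𝕒≈α zero (suc zero) (suc ℓ) m = ≡.refl
𝕒≈α zero (suc (suc k)) ℓ m = ≡.refl

𝕔≈γ : 𝕔 ≈ P₃.const γ
𝕔≈γ (suc n) k ℓ m = ≡.refl
𝕔≈γ zero (suc k) ℓ m = ≡.refl
𝕔≈γ zero zero zero m = ≡.refl
𝕔≈γ zero zero (suc zero) zero = ≡.refl
𝕔≈γ zero zero (suc zero) (suc m) = ≡.refl
𝕔≈γ zero zero (suc (suc ℓ)) m = ≡.refl

𝕕≈δ : 𝕕 ≈ P₃.const δ
𝕕≈δ (suc n) k ℓ m = ≡.refl
𝕕≈δ zero (suc k) ℓ m = ≡.refl
𝕕≈δ zero zero (suc ℓ) m = ≡.refl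
𝕕≈δ zero zero zero zero = ≡.refl
𝕕≈δ zero zero zero (suc zero) = ≡.refl
𝕕≈δ zero zero zero (suc (suc m)) = ≡.refl

^ˢ≈^ : ∀ {x y} → x ≈ y → ∀ i → x ^ˢ i ≈ y ^ i
^ˢ≈^ p zero = one≈1
^ˢ≈^ {x} {y} p (suc i) = trans (⊛≈* x (x ^ˢ i)) (*-cong p (^ˢ≈^ p i))

geom≈geometric : ∀ {x y} → x ≈ y → geom x ≈ Lim.geometric y
geom≈geometric {x} {y} p n k ℓ m = ≡.trans (sumTo-cong n (λ i → ^ˢ≈^ p i n k ℓ m)) (≡.sym (sum₄ n (y ^_) n k ℓ m))

prodInf≈product∞ : ∀ {F G} → (∀ j → F j ≈ G j) → prodInf F ≈ Lim.product∞ G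
prodInf≈product∞ {F} {G} p n = prodTo≈product n n
  where
  prodTo≈product : ∀ N → prodTo N F ≈ Lim.product N G
  prodTo≈product zero = p 0
  prodTo≈product (suc N) = trans (⊛≈* (prodTo N F) (F (suc N))) (*-cong (prodTo≈product N) (p (suc N)))

2*≡double : ∀ j → 2 ℕ.* j ≡ Lim.double j
2*≡double zero = ≡.refl
2*≡double (suc j) = ≡.trans (ℕ.*-suc 2 j) (≡.cong (λ i → suc (suc i)) (2*≡double j))

odd-power : ∀ {x y} → x ≈ y → ∀ j → (x ⊛ 𝕢) ⊛ qpow (2 ℕ.* j) ≈ y * P₃.X ^ suc (Lim.double j)
odd-power {x} {y} p j = trans (⊛≈* (x ⊛ 𝕢) (qpow (2 ℕ.* j)))
  (trans (*-cong (trans (⊛≈* x 𝕢) (*-cong p 𝕢≈X))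
    (trans (qpow≈X^ (2 ℕ.* j)) (CommutativeRing.reflexive R₄ (≡.cong (P₃.X ^_) (2*≡double j)))))
  (⊠-assoc y P₃.X (P₃.X ^ Lim.double j)))

⊖-cong : ∀ {f g} → f ≈ g → ⊖ f ≈ ⊟ g
⊖-cong p = -‿cong p

-- The symbol subtracts its argument, and that argument is itself negated; the two signs cancel to
-- give the factors 1 + ξq^(2j+1).
poch∞≈ : ∀ {x} ξ → x ≈ P₃.const ξ →
         poch∞ (⊖ (x ⊛ 𝕢)) 2 ≈ Lim.product∞ (λ j → Lim.onePlus (P₃.const ξ) (Lim.double j))
poch∞≈ {x} ξ p = prodInf≈product∞ factor
  where
  inner : ∀ j → ⊖ (x ⊛ 𝕢) ⊛ qpow (2 ℕ.* j) ≈ ⊟ (x ⊛ 𝕢) * qpow (2 ℕ.* j)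
  inner j = trans (⊛≈* (⊖ (x ⊛ 𝕢)) (qpow (2 ℕ.* j))) (*-congʳ {qpow (2 ℕ.* j)} (⊖-cong (refl {x ⊛ 𝕢})))
  product : ∀ j → (x ⊛ 𝕢) * qpow (2 ℕ.* j) ≈ P₃.const ξ * P₃.X ^ suc (Lim.double j)
  product j = trans (sym (⊛≈* (x ⊛ 𝕢) (qpow (2 ℕ.* j)))) (odd-power p j)
  negated : ∀ j → ⊖ (⊖ (x ⊛ 𝕢) ⊛ qpow (2 ℕ.* j)) ≈ P₃.const ξ * P₃.X ^ suc (Lim.double j)
  negated j = trans (⊖-cong (inner j)) (Elimination.neg-neg-* R₄ (product j))
  factor : ∀ j → one ⊕ ⊖ (⊖ (x ⊛ 𝕢) ⊛ qpow (2 ℕ.* j)) ≈ Lim.onePlus (P₃.const ξ) (Lim.double j)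
  factor j = Lim.onePlus-intro (P₃.const ξ) (Lim.double j) one≈1 (negated j)

RHS≈ : RHS ≈ Lim.product∞ (λ j → Lim.onePlus (P₃.const α) (Lim.double j))
           * Lim.product∞ (λ j → Lim.onePlus (P₃.const δ) (Lim.double j))
           * Lim.product∞ (Lim.u α γ δ) * Lim.product∞ (λ j → Lim.v α γ δ (Lim.double j))
RHS≈ = times (times (times (poch∞≈ α 𝕒≈α) (poch∞≈ δ 𝕕≈δ))
    (prodInf≈product∞ (λ j → geom≈geometric (power j))))
  (prodInf≈product∞ (λ j → geom≈geometric (odd-power 𝕔≈γ j)))
  where
  times : ∀ {f f′ g g′} → f ≈ f′ → g ≈ g′ → f ⊛ g ≈ f′ * g′
  times {f} {_} {g} p r = trans (⊛≈* f g) (*-cong p r)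
  power : ∀ j → 𝕢 ⊛ qpow (1 ℕ.* j) ≈ P₃.X ^ suc j
  power j = times 𝕢≈X (trans (qpow≈X^ (1 ℕ.* j)) (CommutativeRing.reflexive R₄ (≡.cong (P₃.X ^_) (ℕ.*-identityˡ j))))

-- Generating functions of the counts, and the conclusion.

open Count

monomial : Colour → Series
monomial a = P₃.const α
monomial b = 1#
monomial c = P₃.const γ
monomial d = P₃.const δ

tailSeries : Colour → ℕ → Series
tailSeries y j n k ℓ m = + tailNumber (j , y) n k ℓ m

headedSeries : Colour → ℕ → Series
headedSeries y K n k ℓ m = + headedCount tailNumber y K n k ℓ m

shiftBy≈X^ : ∀ e {f G} {k ℓ m} → (∀ n → + G n ≡ f n k ℓ m) → ∀ n → + shiftBy e G n ≡ (P₃.X ^ e * f) n k ℓ m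
shiftBy≈X^ zero {f} {k = k} {ℓ} {m} p n = ≡.trans (p n) (≡.sym (CommutativeRing.*-identityˡ R₄ f n k ℓ m))
shiftBy≈X^ (suc e) {f} {G} {k} {ℓ} {m} p n = ≡.trans (go n) (≡.sym (⊠-assoc P₃.X (P₃.X ^ e) f n k ℓ m))
  where
  go : ∀ n → + shiftBy (suc e) G n ≡ (P₃.X * (P₃.X ^ e * f)) n k ℓ m
  go zero = ≡.sym (P₃.X·-zero (P₃.X ^ e * f) k ℓ m)
  go (suc n) = ≡.trans (shiftBy≈X^ e p n) (≡.sym (P₃.X·-suc (P₃.X ^ e * f) n k ℓ m))

shiftByPart≈ : ∀ e y {f W} → (∀ n k ℓ m → + W n k ℓ m ≡ f n k ℓ m) →
               ∀ n k ℓ m → + shiftByPart (e , y) W n k ℓ m ≡ (P₃.X ^ e * (monomial y * f)) n k ℓ m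
shiftByPart≈ e y {f} {W} p n k ℓ m = shiftBy≈X^ e (colour y) n
  where
  colour : ∀ y n → + shiftBy (weight a y) (λ k → shiftBy (weight c y) (λ ℓ → shiftBy (weight d y) (W n k ℓ) m) ℓ) k
           ≡ (monomial y * f) n k ℓ m
  colour a n = ≡.trans (shifted k) (≡.sym (P₃.const-· α f n k ℓ m))
    where
    shifted : ∀ k → + shiftBy 1 (λ k → W n k ℓ m) k ≡ (P₂.X P₂.· f n) k ℓ m
    shifted zero = ≡.sym (P₂.X·-zero (f n) ℓ m)
    shifted (suc k) = ≡.trans (p n k ℓ m) (≡.sym (P₂.X·-suc (f n) k ℓ m))
  colour b n = ≡.trans (p n k ℓ m) (≡.sym (CommutativeRing.*-identityˡ R₄ f n k ℓ m))
  colour c n = ≡.trans (shifted ℓ) (≡.sym (≡.trans (P₃.const-· γ f n k ℓ m) (P₂.const-· P₁.X (f n) k ℓ m)))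
    where
    shifted : ∀ ℓ → + shiftBy 1 (λ ℓ → W n k ℓ m) ℓ ≡ (P₁.X P₁.· f n k) ℓ m
    shifted zero = ≡.sym (P₁.X·-zero (f n k) m)
    shifted (suc ℓ) = ≡.trans (p n k ℓ m) (≡.sym (P₁.X·-suc (f n k) ℓ m))
  colour d n = ≡.trans (shifted m) (≡.sym (≡.trans (P₃.const-· δ f n k ℓ m)
    (≡.trans (P₂.const-· (P₁.const P₀.X) (f n) k ℓ m) (P₁.const-· P₀.X (f n k) ℓ m))))
    where
    shifted : ∀ m → + shiftBy 1 (W n k ℓ) m ≡ (P₀.X P₀.· f n k ℓ) m
    shifted zero = ≡.sym (P₀.X·-zero (f n k ℓ))
    shifted (suc m) = ≡.trans (p n k ℓ m) (≡.sym (P₀.X·-suc (f n k ℓ) m))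

headedSeries-suc : ∀ y K → headedSeries y (suc K) ≈
                   headedSeries y K ⊞ P₃.X ^ suc K * (monomial y * tailSeries y (suc K))
headedSeries-suc y K n k ℓ m =
  ≡.cong (λ i → headedSeries y K n k ℓ m ℤ.+ i) (shiftByPart≈ (suc K) y (λ _ _ _ _ → ≡.refl) n k ℓ m)

nilCount≈1 : ∀ n k ℓ m → + nilCount n k ℓ m ≡ 1# n k ℓ m
nilCount≈1 0 0 0 0 = ≡.refl
nilCount≈1 0 0 0 (suc m) = ≡.refl
nilCount≈1 0 0 (suc ℓ) m = ≡.refl
nilCount≈1 0 (suc k) ℓ m = ≡.refl
nilCount≈1 (suc n) k ℓ m = ≡.refl

tailSeries-equation : ∀ x j → tailSeries x j ≈ 1# ⊞ (headedSeries a (j ∸ D x a) ⊞ (headedSeries b (j ∸ D x b)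
                        ⊞ (headedSeries c (j ∸ D x c) ⊞ headedSeries d (j ∸ D x d))))
tailSeries-equation x j n k ℓ m = ≡.trans (≡.cong +_ (tailNumber-equation (j , x) n k ℓ m))
  (≡.cong (λ i → i ℤ.+ (h a ℤ.+ (h b ℤ.+ (h c ℤ.+ h d)))) (nilCount≈1 n k ℓ m))
  where
  h : Colour → ℤ
  h y = headedSeries y (j ∸ D x y) n k ℓ m

module System = Tails.System R₄ P₃.X monomial refl tailSeries headedSeries tailSeries-equation
  (λ _ _ _ _ _ → ≡.refl) headedSeries-suc

tailSeries≈E·K : ∀ j → tailSeries b j ≈ (PowerSeries._·_ R₄ (Lim.E α γ δ) (Lim.K α γ δ)) j
tailSeries≈E·K = Lim.Solution.F≋E·K α γ δ System.F System.V System.F₀ refl System.F₁ System.F-step System.V-step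

theorem1p1 : (n k ℓ m : ℕ) →
    Σ ℕ (λ A → (Fin A ↔ APartitions n k ℓ m) × (RHS n k ℓ m ≡ + A))
theorem1p1 n k ℓ m = tailNumber (N , b) n k ℓ m ,
  APartitions-card k ℓ m (ℕ.m≤m+n (suc n) (Lim.double (suc n))) ,
  ≡.trans (RHS≈ n k ℓ m) (≡.trans (≡.sym (Lim.E·K-coefficient α γ δ n N ℕ.≤-refl k ℓ m))
    (≡.sym (tailSeries≈E·K N n k ℓ m)))
  where
  N : ℕ
  -- This is 3(n + 1): coefficient n is read modulo q^(n+1), and the limit modulo q^m is reached at
  -- index 3m. It also exceeds n, as the fictitious leading part requires.
  N = suc n ℕ.+ Lim.double (suc n)
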